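{- Let $\mathcal{S}$ be a set of $n\ge 1$ coins of identical appearance, among which there may be some counterfeit (fake) coins (any number of them, from $0$ to $n$, this number being unknown in advance), where the fakes are heavier (or: lighter) than the normal coins. Let $g(n)$ be the least number of weighings on a balance needed to sort $\mathcal{S}$ into normal coins and fakes in the worst case, assuming that additional coins known to be normal are available if needed. Then for every $n\neq 3$, $$\lceil n\cdot \log_3 2\rceil \;\le\; g(n)\;\le\; \lceil 7n/11\rceil ,$$ while in the exceptional case $n=3$ one has $g(3)=3$.
   Context: Coins are distinguishable by labels. All normal coins have one common weight and all fake coins have another common weight; the numerical values of the weights are not known, but it is known in advance whether fakes are heavier or lighter than normal coins (the two cases are symmetric). A weighing places two disjoint finite sets of coins (from $\mathcal{S}$ and, if desired, from the supply of additional coins known to be normal) on the left and right pans of a two-pan balance; it reveals only which of the three outcomes holds: left heavier, left lighter, or equal total weight. Weighings are adaptive: each may depend on the outcomes of the previous ones. A strategy sorts $\mathcal{S}$ with at most $k$ weighings if, for every subset $F\subseteq\mathcal{S}$ of fakes (including $F=\varnothing$ and $F=\mathcal{S}$) and whatever the weights are, the outcomes of at most $k$ weighings determine $F$. $g(n)$ is the least such $k$. -}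

module Defs where

open import Algebra.Bundles using (AbelianGroup)
open import Algebra.Structures using (IsAbelianGroup)
import Algebra.Definitions.RawMonoid as RawMonoidDefinitions
open import Data.Bool.Base using (if_then_else_)
open import Data.Fin.Subset using (Subset; _∩_; Empty)
open import Data.Nat.Base using (ℕ; zero; suc; _≤_; _^_; z≤n; s≤s)
open import Data.Nat.Properties using (^-monoˡ-≤; _≤?_)
open import Data.Product.Base using (∃; ∃-syntax; _×_; _,_; proj₁)
import Data.Rational.Base as ℚ
import Data.Rational.Properties as ℚ
open import Data.Vec.Base using (lookup)
open import Level using (Level; 0ℓ; _⊔_) renaming (suc to lsuc)
open import Relation.Binary.Core using (Rel)
open import Relation.Binary.Definitions using (tri<; tri≈; tri>)
open import Relation.Binary.Structures using (IsStrictTotalOrder)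
open import Relation.Binary.PropositionalEquality using (_≡_)
open import Relation.Nullary using (¬_; yes; no; contradiction)
open import Relation.Nullary.Decidable using (from-yes)
open import Relation.Unary using (Pred; Decidable)

private
  variable
    p : Level
    n k : ℕ

------------------------------------------------------------------------
-- Least natural numbers

IsLeast : Pred ℕ p → Pred ℕ p
IsLeast P k = P k × (∀ j → P j → k ≤ j)

least : {P : Pred ℕ p} → Decidable P → ∀ k → P k → ∃ (IsLeast P)
least P? k pk with P? 0
least P? k       pk | yes p₀ = 0 , p₀ , λ _ _ → z≤n
least P? zero    pk | no ¬p₀ = contradiction pk ¬p₀
least P? (suc k) pk | no ¬p₀ with least (λ j → P? (suc j)) k pk
... | m , pm , m≤ = suc m , pm , λ where
  zero    p₀ → contradiction p₀ ¬p₀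
  (suc j) pj → s≤s (m≤ j pj)

-- The ceiling of the real number n · log₃ 2 is the least m with
-- n · log₃ 2 ≤ m, and this inequality says 2 ^ n ≤ 3 ^ m.

⌈_·log₃2⌉ : ℕ → ℕ
⌈ n ·log₃2⌉ = proj₁ (least (λ m → 2 ^ n ≤? 3 ^ m) n (^-monoˡ-≤ n (from-yes (2 ≤? 3))))

------------------------------------------------------------------------
-- Weights

-- Weights are positive elements of a nontrivial totally ordered abelian
-- group; the intended one is (ℝ, +, <). Only addition and comparison of
-- weights play a role in a weighing.

record OrderedAbelianGroup c ℓ₁ ℓ₂ : Set (lsuc (c ⊔ ℓ₁ ⊔ ℓ₂)) where
  infix  4 _≈_ _<_
  infixl 6 _+_
  field
    Carrier            : Set c
    _≈_                : Rel Carrier ℓ₁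
    _<_                : Rel Carrier ℓ₂
    _+_                : Carrier → Carrier → Carrier
    0#                 : Carrier
    1#                 : Carrier
    -_                 : Carrier → Carrier
    isAbelianGroup     : IsAbelianGroup _≈_ _+_ 0# -_
    isStrictTotalOrder : IsStrictTotalOrder _≈_ _<_
    +-monoʳ-<          : ∀ x {y z} → y < z → (x + y) < (x + z)
    0<1                : 0# < 1#

  abelianGroup : AbelianGroup c ℓ₁
  abelianGroup = record { isAbelianGroup = isAbelianGroup }

  open AbelianGroup abelianGroup public using (rawMonoid)
  open IsStrictTotalOrder isStrictTotalOrder public using (compare)

ℚ-orderedAbelianGroup : OrderedAbelianGroup 0ℓ 0ℓ 0ℓ
ℚ-orderedAbelianGroup = record
  { isAbelianGroup     = ℚ.+-0-isAbelianGroup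
  ; isStrictTotalOrder = ℚ.<-isStrictTotalOrder
  ; +-monoʳ-<          = ℚ.+-monoʳ-<
  ; 0<1                = from-yes (ℚ.0ℚ ℚ.<? ℚ.1ℚ)
  }

------------------------------------------------------------------------
-- Weighings and strategies for the coins Fin n

-- Whether the fakes are heavier or lighter than the normal coins.

data FakeKind : Set where
  heavier lighter : FakeKind

data Outcome : Set where
  leftHeavier leftLighter balanced : Outcome

-- The coins from the supply are normal and hence interchangeable, so
-- only the number of them on each pan is recorded.

record Weighing (n : ℕ) : Set where
  field
    left right            : Subset n
    disjoint              : Empty (left ∩ right)
    extraLeft extraRight  : ℕ

-- An adaptive strategy with at most k weighings. It has no access to the
-- weights or to the set of fakes other than through the outcomes.

data Strategy (n : ℕ) : ℕ → Set where
  answer : Subset n → Strategy n k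
  weigh  : Weighing n → (Outcome → Strategy n k) → Strategy n (suc k)

module _ {c ℓ₁ ℓ₂} (W : OrderedAbelianGroup c ℓ₁ ℓ₂) where
  open OrderedAbelianGroup W
  open RawMonoidDefinitions rawMonoid using (sum) renaming (_×_ to _·_)

  FakeVsNormal : FakeKind → Rel Carrier ℓ₂
  FakeVsNormal heavier fake normal = normal < fake
  FakeVsNormal lighter fake normal = fake < normal

  record Weights (kind : FakeKind) : Set (c ⊔ ℓ₂) where
    field
      normal fake  : Carrier
      0<normal     : 0# < normal
      0<fake       : 0# < fake
      fakeVsNormal : FakeVsNormal kind fake normal

  module _ {kind : FakeKind} (w : Weights kind) (F : Subset n) where
    open Weights w

    panWeight : Subset n → ℕ → Carrier
    panWeight S extra =
      sum (λ i → if lookup S i then (if lookup F i then fake else normal) else 0#)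
        + extra · normal

    outcome : Weighing n → Outcome
    outcome v with compare (panWeight left extraLeft) (panWeight right extraRight)
      where open Weighing v
    ... | tri< _ _ _ = leftLighter
    ... | tri≈ _ _ _ = balanced
    ... | tri> _ _ _ = leftHeavier

    result : Strategy n k → Subset n
    result (answer G)  = G
    result (weigh v s) = result (s (outcome v))

  Sorts : FakeKind → Strategy n k → Set (c ⊔ ℓ₂)
  Sorts {n} kind s = (F : Subset n) (w : Weights kind) → result w F s ≡ F

  Sortable : FakeKind → ℕ → Pred ℕ (c ⊔ ℓ₂)
  Sortable kind n k = ∃[ s ] Sorts {n} {k} kind s

{-# OPTIONS --safe #-}

-- If the two weights are (n+1)·u and (n+2)·u, two pans with different
-- numbers of coins compare the same way whatever F ⊆ S is, because at
-- most n fakes lie on each pan. Hence only weighings with equally many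
-- coins on both pans are informative, and these compare the numbers of
-- fakes on the pans, whatever the weights are. So a strategy amounts to
-- a finite decision tree (a plan), and solvability by plans is decidable.
-- A plan with k weighings has at most 3 ^ k leaves, which is the lower
-- bound. Plans for disjoint sets of coins can be carried out one after
-- the other, so for the upper bound it suffices to have 11 coins in 7
-- weighings and good plans for n < 11; as 3 coins are exceptional,
-- 14 = 11 + 3 coins need a plan of their own, with 9 weighings.

module Submission where

open import Defs
open import Algebra.Bundles using (AbelianGroup)
import Algebra.Properties.CommutativeSemigroup
import Algebra.Properties.Monoid.Mult
open import Data.Bool.Base using (if_then_else_)
import Data.Bool.Properties as Bool
open import Data.Char.Base as Char using (Char)
open import Data.Fin.Base using (zero; suc)
open import Data.Fin.Subset using (Subset; inside; outside; _∩_; _─_; ∣_∣; Empty; ⋃; ⋂)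
open import Data.Fin.Subset.Properties using (∣p∣≤n)
open import Data.Integer.Base as ℤ using (ℤ; +_)
import Data.Integer.DivMod as ℤ
import Data.Integer.Properties as ℤ
open import Data.List.Base as List using (List; []; _∷_; length; filter)
open import Data.List.Membership.Propositional using (_∈_)
open import Data.List.Membership.Propositional.Properties
  using (∈-filter⁺; ∈-filter⁻; ∈-map⁺; ∈-map⁻; ∈-++⁺ˡ; ∈-++⁺ʳ)
import Data.List.Properties as List
open import Data.List.Relation.Unary.All as All using (All; []; _∷_)
open import Data.List.Relation.Unary.AllPairs using ([]; _∷_)
open import Data.List.Relation.Unary.Any using (here)
open import Data.List.Relation.Unary.Unique.Propositional using (Unique)
import Data.List.Relation.Unary.Unique.Propositional.Properties as Unique
open import Data.Maybe.Base as Maybe using (Maybe; just; nothing; from-just)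
open import Data.Nat.Base as ℕ
  using (ℕ; zero; suc; _+_; _*_; _^_; _∸_; _≤_; _<_; z≤n; s≤s; _≤′_; ≤′-refl; ≤′-step)
open import Data.Nat.Properties as ℕ using (_≟_; _≤?_; _<?_; <-cmp)
open import Data.Nat.Tactic.RingSolver using (solve-∀)
open import Data.Product.Base using (_×_; _,_; proj₁; proj₂; ∃-syntax; map₂)
open import Data.Rational.Unnormalised.Base using (_/_; ceiling)
open import Data.String.Base using (String; toList; words)
open import Data.Sum.Base using (inj₁; inj₂; [_,_]′)
open import Data.Vec.Base as Vec using (Vec; []; _∷_; _++_; here; there)
import Data.Vec.Properties as Vec
open import Function.Base using (_∘_; const)
open import Relation.Binary.Bundles using (StrictTotalOrder)
open import Relation.Binary.Definitions using (DecidableEquality; tri<; tri≈; tri>)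
open import Relation.Binary.PropositionalEquality
  using (_≡_; _≢_; refl; sym; trans; cong; cong₂; subst; subst₂; module ≡-Reasoning)
import Relation.Binary.Reasoning.StrictPartialOrder
open import Relation.Nullary using (Dec; yes; no; does; ¬_; contradiction)
open import Relation.Nullary.Decidable
  using (map′; _⊎-dec_; _×-dec_; dec-true; dec-false; from-yes; from-no; True; toWitness)
open import Relation.Unary using (Decidable)

private
  variable
    k l m n : ℕ

-- Plans

_≟ₒ_ : DecidableEquality Outcome
leftHeavier ≟ₒ leftHeavier = yes refl
leftHeavier ≟ₒ leftLighter = no λ ()
leftHeavier ≟ₒ balanced    = no λ ()
leftLighter ≟ₒ leftHeavier = no λ ()
leftLighter ≟ₒ leftLighter = yes refl
leftLighter ≟ₒ balanced    = no λ ()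
balanced    ≟ₒ leftHeavier = no λ ()
balanced    ≟ₒ leftLighter = no λ ()
balanced    ≟ₒ balanced    = yes refl

_≟ₛ_ : DecidableEquality (Subset n)
_≟ₛ_ = Vec.≡-dec Bool._≟_

data Pan : Set where
  onLeft onRight aside : Pan

Placement : ℕ → Set
Placement = Vec Pan

idle : Placement n
idle = Vec.replicate _ aside

fakesLeft fakesRight : Placement n → Subset n → ℕ
fakesLeft []           []           = 0
fakesLeft (onLeft ∷ p) (inside ∷ F) = suc (fakesLeft p F)
fakesLeft (_ ∷ p)      (_ ∷ F)      = fakesLeft p F
fakesRight []            []           = 0
fakesRight (onRight ∷ p) (inside ∷ F) = suc (fakesRight p F)
fakesRight (_ ∷ p)       (_ ∷ F)      = fakesRight p F

-- Independently of the kind of the fakes, the pan with more of them counts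
-- as the heavier one.
compareLoads : ℕ → ℕ → Outcome
compareLoads a b =
  if does (a <? b) then leftLighter else if does (b <? a) then leftHeavier else balanced

tip : Placement n → Subset n → Outcome
tip p F = compareLoads (fakesLeft p F) (fakesRight p F)

data Plan (n : ℕ) : ℕ → Set where
  answer : Subset n → Plan n k
  weigh  : Placement n → (Outcome → Plan n k) → Plan n (suc k)

identify : Plan n k → Subset n → Subset n
identify (answer G)  F = G
identify (weigh p s) F = identify (s (tip p F)) F

-- Solvability relative to a list of remaining candidates. A weighing splits such a list into three,
-- so both the decision procedure and the counting bound can recurse on `k`, which `Solvable` itself
-- does not allow.
Distinguishable : ℕ → List (Subset n) → Set
Distinguishable {n} k Fs = ∃[ s ] All (λ F → identify {n} {k} s F ≡ F) Fs

Solvable : ℕ → ℕ → Set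
Solvable n k = ∃[ s ] ∀ F → identify {n} {k} s F ≡ F

-- Enumeration of the possible sets of fakes

allSubsets : ∀ n → List (Subset n)
allSubsets zero    = [] ∷ []
allSubsets (suc n) = List.map (inside ∷_) (allSubsets n) List.++ List.map (outside ∷_) (allSubsets n)

∈-allSubsets : (F : Subset n) → F ∈ allSubsets n
∈-allSubsets []            = here refl
∈-allSubsets (inside ∷ F)  = ∈-++⁺ˡ (∈-map⁺ (inside ∷_) (∈-allSubsets F))
∈-allSubsets (outside ∷ F) = ∈-++⁺ʳ _ (∈-map⁺ (outside ∷_) (∈-allSubsets F))

length-allSubsets : ∀ n → length (allSubsets n) ≡ 2 ^ n
length-allSubsets zero    = refl
length-allSubsets (suc n) = begin
  length (allSubsets (suc n))
    ≡⟨ List.length-++ (List.map (inside ∷_) (allSubsets n)) ⟩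
  length (List.map (inside ∷_) (allSubsets n)) + length (List.map (outside ∷_) (allSubsets n))
    ≡⟨ cong₂ _+_ (List.length-map _ (allSubsets n)) (List.length-map _ (allSubsets n)) ⟩
  length (allSubsets n) + length (allSubsets n)
    ≡⟨ cong (λ x → x + x) (length-allSubsets n) ⟩
  2 ^ n + 2 ^ n
    ≡⟨ cong (λ x → 2 ^ n + x) (ℕ.+-identityʳ _) ⟨
  2 ^ suc n ∎
  where open ≡-Reasoning

allSubsets-! : ∀ n → Unique (allSubsets n)
allSubsets-! zero    = [] ∷ []
allSubsets-! (suc n) = Unique.++⁺
  (Unique.map⁺ Vec.∷-injectiveʳ (allSubsets-! n))
  (Unique.map⁺ Vec.∷-injectiveʳ (allSubsets-! n))
  λ (∈i , ∈o) → disjoint (∈-map⁻ _ ∈i) (∈-map⁻ _ ∈o)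
  where
  disjoint : ∀ {F : Subset (suc n)} →
             (∃[ G ] G ∈ allSubsets n × F ≡ inside ∷ G) →
             ¬ (∃[ G ] G ∈ allSubsets n × F ≡ outside ∷ G)
  disjoint (_ , _ , refl) (_ , _ , ())

-- Reduction to the situation after the first weighing

distinguishable⇒solvable : Distinguishable k (allSubsets n) → Solvable n k
distinguishable⇒solvable = map₂ λ s F → All.lookup s (∈-allSubsets F)

solvable⇒distinguishable : Solvable n k → ∀ Fs → Distinguishable k Fs
solvable⇒distinguishable (s , sorts) Fs = s , All.universal sorts Fs

-- The lists `after o` are kept abstract: it suffices that each candidate survives into the list of
-- its own outcome. The decision procedure takes `consistent` for them, the guided search `select`.
weigh-distinguishes : (p : Placement n) {Fs : List (Subset n)}
                      (after : Outcome → List (Subset n)) →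
                      (∀ {F} → F ∈ Fs → F ∈ after (tip p F)) →
                      (∀ o → Distinguishable k (after o)) → Distinguishable (suc k) Fs
weigh-distinguishes p after ∈-after d =
  weigh p (proj₁ ∘ d) , All.tabulate λ F∈Fs → All.lookup (proj₂ (d _)) (∈-after F∈Fs)

consistent : Placement n → List (Subset n) → Outcome → List (Subset n)
consistent p Fs o = filter (λ F → tip p F ≟ₒ o) Fs

distinguishable-suc : {Fs : List (Subset n)} → Distinguishable (suc k) Fs →
                      ∃[ p ] (∀ o → Distinguishable k (consistent p Fs o))
distinguishable-suc {Fs = Fs} (answer G , sorts) =
  -- An early answer is preceded by an idle weighing and repeated in each branch, so that every plan
  -- with a positive budget has a first weighing.
  idle , λ o → answer G ,
  All.tabulate (All.lookup sorts ∘ proj₁ ∘ ∈-filter⁻ (λ F → tip idle F ≟ₒ o))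
distinguishable-suc {Fs = Fs} (weigh p s , sorts) = p , λ o → s o , All.tabulate λ {F} F∈ →
  let F∈Fs , tip≡o = ∈-filter⁻ (λ F → tip p F ≟ₒ o) {xs = Fs} F∈
  in subst (λ o → identify (s o) F ≡ F) tip≡o (All.lookup sorts F∈Fs)

-- Monotonicity in the number of weighings

weaken : Plan n k → Plan n (suc k)
weaken (answer G)  = answer G
weaken (weigh p s) = weigh p (weaken ∘ s)

identify-weaken : (s : Plan n k) (F : Subset n) → identify (weaken s) F ≡ identify s F
identify-weaken (answer G)  F = refl
identify-weaken (weigh p s) F = identify-weaken (s (tip p F)) F

solvable-suc : Solvable n k → Solvable n (suc k)
solvable-suc (s , sorts) = weaken s , λ F → trans (identify-weaken s F) (sorts F)

solvable-mono : k ≤ l → Solvable n k → Solvable n l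
solvable-mono k≤l = go (ℕ.≤⇒≤′ k≤l)
  where
  go : k ≤′ l → Solvable n k → Solvable n l
  go ≤′-refl       s = s
  go (≤′-step k≤l) s = solvable-suc (go k≤l s)

-- Decidability of solvability

anyPlacement? : {P : Placement n → Set} → Decidable P → Dec (∃[ p ] P p)
anyPlacement? {zero}  P? = map′ ([] ,_) (λ { ([] , p) → p }) (P? [])
anyPlacement? {suc n} P? = map′
  [ (λ (p , x) → onLeft ∷ p , x)
  , [ (λ (p , x) → onRight ∷ p , x) , (λ (p , x) → aside ∷ p , x) ]′ ]′
  (λ { (onLeft ∷ p , x)  → inj₁ (p , x)
     ; (onRight ∷ p , x) → inj₂ (inj₁ (p , x))
     ; (aside ∷ p , x)   → inj₂ (inj₂ (p , x)) })
  (anyPlacement? (P? ∘ (onLeft ∷_))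
    ⊎-dec anyPlacement? (P? ∘ (onRight ∷_))
    ⊎-dec anyPlacement? (P? ∘ (aside ∷_)))

allOutcomes? : {P : Outcome → Set} → Decidable P → Dec (∀ o → P o)
allOutcomes? P? = map′
  (λ { (x , y , z) leftHeavier → x ; (x , y , z) leftLighter → y ; (x , y , z) balanced → z })
  (λ f → f leftHeavier , f leftLighter , f balanced)
  (P? leftHeavier ×-dec P? leftLighter ×-dec P? balanced)

-- Exhaustive search over the finitely many first placements; `distinguishable-suc` and
-- `weigh-distinguishes` show that nothing is lost or gained by passing to the three lists of
-- consistent candidates.
distinguishable? : ∀ k → Decidable (Distinguishable {n} k)
-- No candidate is left, so the choice of the answer is arbitrary.
distinguishable? zero []       = yes (answer (Vec.replicate _ outside) , [])
distinguishable? zero (F ∷ Fs) = map′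
  (λ all → answer F , refl ∷ all)
  (λ { (answer G , refl ∷ all) → all })
  (All.all? (F ≟ₛ_) Fs)
distinguishable? (suc k) Fs = map′
  (λ (p , d) → weigh-distinguishes p (consistent p Fs)
    (λ F∈ → ∈-filter⁺ (λ F → tip p F ≟ₒ _) F∈ refl) d)
  distinguishable-suc
  (anyPlacement? λ p → allOutcomes? λ o → distinguishable? k (consistent p Fs o))

-- This serves two purposes: evaluated at 3 coins and 2 weighings it settles the exceptional case,
-- and for arbitrary `n` it makes the least number of weighings available constructively.
solvable? : ∀ n → Decidable (Solvable n)
solvable? n k = map′ distinguishable⇒solvable (λ s → solvable⇒distinguishable s _)
  (distinguishable? k (allSubsets n))

-- The counting bound

length-consistent : (p : Placement n) (Fs : List (Subset n)) →
  length Fs ≡ length (consistent p Fs leftHeavier) +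
    (length (consistent p Fs leftLighter) + length (consistent p Fs balanced))
length-consistent p []       = refl
length-consistent p (F ∷ Fs) with tip p F | length-consistent p Fs
... | leftHeavier | eq = cong suc eq
... | leftLighter | eq = trans (cong suc eq) (sym (ℕ.+-suc _ _))
... | balanced    | eq = trans (cong suc eq)
  (trans (sym (ℕ.+-suc a _)) (cong (λ x → a + x) (sym (ℕ.+-suc _ _))))
  where
  a : ℕ
  a = length (consistent p Fs leftHeavier)

-- Each weighing partitions the candidates into three lists, each of length at most `3 ^ k` by
-- induction. Uniqueness matters at the bottom, where a single answer can be right for one candidate
-- only.
distinguishable-length : ∀ k {Fs : List (Subset n)} →
                         Unique Fs → Distinguishable k Fs → length Fs ≤ 3 ^ k
distinguishable-length zero []       d = z≤n
distinguishable-length zero (_ ∷ []) d = ℕ.≤-refl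
-- Without weighings the plan is one answer, which both of two distinct candidates would have to
-- equal.
distinguishable-length zero ((F≢G ∷ _) ∷ _ ∷ _) (answer _ , refl ∷ refl ∷ _) =
  contradiction refl F≢G
distinguishable-length (suc k) {Fs} Fs! d with distinguishable-suc d
... | p , d′ = begin
  length Fs
    ≡⟨ length-consistent p Fs ⟩
  length (consistent p Fs leftHeavier) +
    (length (consistent p Fs leftLighter) + length (consistent p Fs balanced))
    ≤⟨ ℕ.+-mono-≤ (bound leftHeavier) (ℕ.+-mono-≤ (bound leftLighter) (bound balanced)) ⟩
  3 ^ k + (3 ^ k + 3 ^ k)
    ≡⟨ cong (λ x → 3 ^ k + (3 ^ k + x)) (ℕ.+-identityʳ (3 ^ k)) ⟨
  3 ^ suc k ∎
  where
  open ℕ.≤-Reasoning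
  bound : ∀ o → length (consistent p Fs o) ≤ 3 ^ k
  bound o = distinguishable-length k (Unique.filter⁺ _ Fs!) (d′ o)

solvable⇒2^n≤3^k : Solvable n k → 2 ^ n ≤ 3 ^ k
solvable⇒2^n≤3^k {n} {k} s = begin
  2 ^ n                 ≡⟨ length-allSubsets n ⟨
  length (allSubsets n) ≤⟨ distinguishable-length k (allSubsets-! n)
                             (solvable⇒distinguishable s _) ⟩
  3 ^ k                 ∎
  where open ℕ.≤-Reasoning

-- Plans carried out one after the other

behind : Subset m → Plan n k → Plan (m + n) k
behind G (answer H)  = answer (G ++ H)
behind G (weigh p s) = weigh (idle ++ p) (behind G ∘ s)

-- If the first plan answers before its budget is exhausted, the recursion on `k` pads the result
-- with `weaken`, so that the index is `k + l` on every branch.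
_⊕_ : Plan m k → Plan n l → Plan (m + n) (k + l)
_⊕_ {k = zero}  (answer G)  t = behind G t
_⊕_ {k = suc k} (answer G)  t = weaken (answer {k = k} G ⊕ t)
_⊕_ (weigh p s) t = weigh (p ++ idle) λ o → s o ⊕ t

fakesLeft-idle : (F : Subset n) → fakesLeft idle F ≡ 0
fakesLeft-idle []      = refl
fakesLeft-idle (_ ∷ F) = fakesLeft-idle F

fakesRight-idle : (F : Subset n) → fakesRight idle F ≡ 0
fakesRight-idle []      = refl
fakesRight-idle (_ ∷ F) = fakesRight-idle F

fakesLeft-++ : (p : Placement m) {q : Placement n} (F : Subset m) {H : Subset n} →
               fakesLeft (p ++ q) (F ++ H) ≡ fakesLeft p F + fakesLeft q H
fakesLeft-++ []            []            = refl
fakesLeft-++ (onLeft ∷ p)  (inside ∷ F)  = cong suc (fakesLeft-++ p F)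
fakesLeft-++ (onLeft ∷ p)  (outside ∷ F) = fakesLeft-++ p F
fakesLeft-++ (onRight ∷ p) (_ ∷ F)       = fakesLeft-++ p F
fakesLeft-++ (aside ∷ p)   (_ ∷ F)       = fakesLeft-++ p F

fakesRight-++ : (p : Placement m) {q : Placement n} (F : Subset m) {H : Subset n} →
                fakesRight (p ++ q) (F ++ H) ≡ fakesRight p F + fakesRight q H
fakesRight-++ []            []            = refl
fakesRight-++ (onRight ∷ p) (inside ∷ F)  = cong suc (fakesRight-++ p F)
fakesRight-++ (onRight ∷ p) (outside ∷ F) = fakesRight-++ p F
fakesRight-++ (onLeft ∷ p)  (_ ∷ F)       = fakesRight-++ p F
fakesRight-++ (aside ∷ p)   (_ ∷ F)       = fakesRight-++ p F

tip-++-idle : (p : Placement m) (F : Subset m) {H : Subset n} → tip (p ++ idle) (F ++ H) ≡ tip p F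
tip-++-idle p F {H}
  rewrite fakesLeft-++ p {idle} F {H} | fakesRight-++ p {idle} F {H}
        | fakesLeft-idle H | fakesRight-idle H
        | ℕ.+-identityʳ (fakesLeft p F) | ℕ.+-identityʳ (fakesRight p F) = refl

tip-idle-++ : (p : Placement n) (F : Subset m) {H : Subset n} → tip (idle ++ p) (F ++ H) ≡ tip p H
tip-idle-++ p F {H}
  rewrite fakesLeft-++ idle {p} F {H} | fakesRight-++ idle {p} F {H}
        | fakesLeft-idle F | fakesRight-idle F = refl

identify-behind : (t : Plan n k) (G F : Subset m) (H : Subset n) →
                  identify (behind G t) (F ++ H) ≡ G ++ identify t H
identify-behind (answer _)  G F H = refl
identify-behind (weigh p s) G F H rewrite tip-idle-++ p F {H} = identify-behind (s (tip p H)) G F H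

-- While one plan is running, the coins of the other lie aside and contribute no fakes to either
-- pan, so the two do not interact.
identify-⊕ : (s : Plan m k) (t : Plan n l) (F : Subset m) (H : Subset n) →
             identify (s ⊕ t) (F ++ H) ≡ identify s F ++ identify t H
identify-⊕ {k = zero}  (answer G)  t F H = identify-behind t G F H
identify-⊕ {k = suc k} (answer G)  t F H =
  trans (identify-weaken (answer {k = k} G ⊕ t) (F ++ H)) (identify-⊕ {k = k} (answer G) t F H)
identify-⊕ (weigh p s) t F H rewrite tip-++-idle p F {H} = identify-⊕ (s (tip p F)) t F H

solvable-+ : Solvable m k → Solvable n l → Solvable (m + n) (k + l)
solvable-+ {m} (s , sorts-s) (t , sorts-t) = s ⊕ t , λ FH →
  let F , H , FH≡ = Vec.splitAt m FH in
  subst (λ X → identify (s ⊕ t) X ≡ X) (sym FH≡)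
    (trans (identify-⊕ s t F H) (cong₂ _++_ (sorts-s F) (sorts-t H)))

-- Counting does not exclude this, since `2 ^ 3` is 8 and `3 ^ 2` is 9. The refutation is the
-- evaluated exhaustive search.
¬solvable-3-2 : ¬ Solvable 3 2
¬solvable-3-2 = from-no (solvable? 3 2)

-- Plans and strategies

compareLoads-< : k < l → compareLoads k l ≡ leftLighter
compareLoads-< {k} {l} k<l rewrite dec-true (k <? l) k<l = refl

compareLoads-≡ : k ≡ l → compareLoads k l ≡ balanced
compareLoads-≡ {k} refl rewrite dec-false (k <? k) (ℕ.<-irrefl refl) = refl

compareLoads-> : l < k → compareLoads k l ≡ leftHeavier
compareLoads-> {l} {k} l<k rewrite dec-false (k <? l) (ℕ.<-asym l<k) | dec-true (l <? k) l<k = refl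

-- Placements as pairs of disjoint pans

leftPan rightPan : Placement n → Subset n
leftPan []            = []
leftPan (onLeft ∷ p)  = inside ∷ leftPan p
leftPan (onRight ∷ p) = outside ∷ leftPan p
leftPan (aside ∷ p)   = outside ∷ leftPan p
rightPan []            = []
rightPan (onLeft ∷ p)  = outside ∷ rightPan p
rightPan (onRight ∷ p) = inside ∷ rightPan p
rightPan (aside ∷ p)   = outside ∷ rightPan p

pans-disjoint : (p : Placement n) → Empty (leftPan p ∩ rightPan p)
pans-disjoint (onLeft ∷ p)  (suc i , there i∈) = pans-disjoint p (i , i∈)
pans-disjoint (onRight ∷ p) (suc i , there i∈) = pans-disjoint p (i , i∈)
pans-disjoint (aside ∷ p)   (suc i , there i∈) = pans-disjoint p (i , i∈)

fakesLeft-leftPan : (p : Placement n) (F : Subset n) → fakesLeft p F ≡ ∣ leftPan p ∩ F ∣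
fakesLeft-leftPan []            []            = refl
fakesLeft-leftPan (onLeft ∷ p)  (inside ∷ F)  = cong suc (fakesLeft-leftPan p F)
fakesLeft-leftPan (onLeft ∷ p)  (outside ∷ F) = fakesLeft-leftPan p F
fakesLeft-leftPan (onRight ∷ p) (_ ∷ F)       = fakesLeft-leftPan p F
fakesLeft-leftPan (aside ∷ p)   (_ ∷ F)       = fakesLeft-leftPan p F

fakesRight-rightPan : (p : Placement n) (F : Subset n) → fakesRight p F ≡ ∣ rightPan p ∩ F ∣
fakesRight-rightPan []            []            = refl
fakesRight-rightPan (onRight ∷ p) (inside ∷ F)  = cong suc (fakesRight-rightPan p F)
fakesRight-rightPan (onRight ∷ p) (outside ∷ F) = fakesRight-rightPan p F
fakesRight-rightPan (onLeft ∷ p)  (_ ∷ F)       = fakesRight-rightPan p F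
fakesRight-rightPan (aside ∷ p)   (_ ∷ F)       = fakesRight-rightPan p F

-- Each pan gets as many supply coins as there are coins of S on the
-- other one, so that both pans hold equally many coins.
weighing : Placement n → Weighing n
weighing p = record
  { left       = leftPan p
  ; right      = rightPan p
  ; disjoint   = pans-disjoint p
  ; extraLeft  = ∣ rightPan p ∣
  ; extraRight = ∣ leftPan p ∣
  }

-- A coin in both sets is put on the left; disjointness excludes this case in `rightPan-placement`.
placement : Subset n → Subset n → Placement n
placement []            []            = []
placement (inside ∷ L)  (_ ∷ R)       = onLeft ∷ placement L R
placement (outside ∷ L) (inside ∷ R)  = onRight ∷ placement L R
placement (outside ∷ L) (outside ∷ R) = aside ∷ placement L R

leftPan-placement : (L R : Subset n) → leftPan (placement L R) ≡ L
leftPan-placement []            []            = refl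
leftPan-placement (inside ∷ L)  (_ ∷ R)       = cong (inside ∷_) (leftPan-placement L R)
leftPan-placement (outside ∷ L) (inside ∷ R)  = cong (outside ∷_) (leftPan-placement L R)
leftPan-placement (outside ∷ L) (outside ∷ R) = cong (outside ∷_) (leftPan-placement L R)

rightPan-placement : (L R : Subset n) → Empty (L ∩ R) → rightPan (placement L R) ≡ R
rightPan-placement []            []            _ = refl
rightPan-placement (inside ∷ L)  (inside ∷ R)  e = contradiction (zero , here) e
rightPan-placement (inside ∷ L)  (outside ∷ R) e =
  cong (outside ∷_) (rightPan-placement L R λ (i , i∈) → e (suc i , there i∈))
rightPan-placement (outside ∷ L) (inside ∷ R)  e =
  cong (inside ∷_) (rightPan-placement L R λ (i , i∈) → e (suc i , there i∈))
rightPan-placement (outside ∷ L) (outside ∷ R) e =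
  cong (outside ∷_) (rightPan-placement L R λ (i , i∈) → e (suc i , there i∈))

∣∩∣+∣─∣ : (S F : Subset n) → ∣ S ∩ F ∣ + ∣ S ─ F ∣ ≡ ∣ S ∣
∣∩∣+∣─∣ []            []            = refl
∣∩∣+∣─∣ (inside ∷ S)  (inside ∷ F)  = cong suc (∣∩∣+∣─∣ S F)
∣∩∣+∣─∣ (inside ∷ S)  (outside ∷ F) = trans (ℕ.+-suc _ _) (cong suc (∣∩∣+∣─∣ S F))
∣∩∣+∣─∣ (outside ∷ S) (inside ∷ F)  = ∣∩∣+∣─∣ S F
∣∩∣+∣─∣ (outside ∷ S) (outside ∷ F) = ∣∩∣+∣─∣ S F

-- Translates between `tip`, which reports the pan with more fakes as the heavier one, and the
-- balance: if fakes are lighter, left and right are exchanged. Being an involution, it translates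
-- in both directions.
perceived : FakeKind → Outcome → Outcome
perceived heavier o           = o
perceived lighter leftHeavier = leftLighter
perceived lighter leftLighter = leftHeavier
perceived lighter balanced    = balanced

perceived-involutive : ∀ kind o → perceived kind (perceived kind o) ≡ o
perceived-involutive heavier o           = refl
perceived-involutive lighter leftHeavier = refl
perceived-involutive lighter leftLighter = refl
perceived-involutive lighter balanced    = refl

perceived-balanced : ∀ kind → perceived kind balanced ≡ balanced
perceived-balanced heavier = refl
perceived-balanced lighter = refl

-- Translation of plans into strategies and back

strategy : FakeKind → Plan n k → Strategy n k
strategy kind (answer G)  = answer G
strategy kind (weigh p s) = weigh (weighing p) λ o → strategy kind (s (perceived kind o))

leftCount rightCount : Weighing n → ℕ
leftCount v  = ∣ Weighing.left v ∣ + Weighing.extraLeft v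
rightCount v = ∣ Weighing.right v ∣ + Weighing.extraRight v

-- The adversary's weights, in multiples of 1#.
fakeUnits normalUnits : ℕ → FakeKind → ℕ
fakeUnits n heavier = suc (suc n)
fakeUnits n lighter = suc n

normalUnits n heavier = suc n
normalUnits n lighter = suc (suc n)

-- A weighing with unequal numbers of coins on the pans is skipped, as its
-- outcome under the adversary's weights is known in advance.
plan : FakeKind → Strategy n k → Plan n k
plan kind (answer G)  = answer G
plan kind (weigh v s) with <-cmp (leftCount v) (rightCount v)
... | tri< _ _ _ = weaken (plan kind (s leftLighter))
... | tri≈ _ _ _ = weigh (placement (Weighing.left v) (Weighing.right v))
                     λ o → plan kind (s (perceived kind o))
... | tri> _ _ _ = weaken (plan kind (s leftHeavier))

panCount : (S F : Subset n) (extra : ℕ) → ∣ S ∣ + extra ≡ ∣ S ∩ F ∣ + (∣ S ─ F ∣ + extra)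
panCount S F extra = trans
  (cong (_+ extra) (sym (∣∩∣+∣─∣ S F)))
  (ℕ.+-assoc ∣ S ∩ F ∣ ∣ S ─ F ∣ extra)

-- The pans hold a and b fakes and m and l normal coins, respectively.
units-< : ∀ n kind {a b m l} → a ≤ n → b ≤ n → a + m < b + l →
          a * fakeUnits n kind + m * normalUnits n kind <
          b * fakeUnits n kind + l * normalUnits n kind
-- A pan weighs `suc n` times its number of coins plus its number of fakes. The latter is at most
-- `n`, so it cannot make up for a missing coin.
units-< n heavier {a} {b} {m} {l} a≤n b≤n lt = begin-strict
  a * suc (suc n) + m * suc n ≡⟨ lemma n a m ⟩
  a + (a + m) * suc n         <⟨ ℕ.+-monoˡ-< _ (s≤s a≤n) ⟩
  suc (a + m) * suc n         ≤⟨ ℕ.*-monoˡ-≤ (suc n) lt ⟩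
  (b + l) * suc n             ≤⟨ ℕ.m≤n+m _ b ⟩
  b + (b + l) * suc n         ≡⟨ lemma n b l ⟨
  b * suc (suc n) + l * suc n ∎
  where
  open ℕ.≤-Reasoning
  lemma : ∀ n a m → a * suc (suc n) + m * suc n ≡ a + (a + m) * suc n
  lemma = solve-∀
-- Here a pan weighs `suc (suc n)` times its number of coins minus its number of fakes; adding `b`
-- on both sides avoids the subtraction.
units-< n lighter {a} {b} {m} {l} a≤n b≤n lt = ℕ.+-cancelˡ-< b _ _ (begin-strict
  b + (a * suc n + m * suc (suc n))       ≤⟨ ℕ.+-monoʳ-≤ b (ℕ.m≤n+m _ a) ⟩
  b + (a + (a * suc n + m * suc (suc n))) ≡⟨ cong (λ x → b + x) (lemma n a m) ⟩
  b + (a + m) * suc (suc n)               <⟨ ℕ.+-monoˡ-< _ (s≤s (ℕ.m≤n⇒m≤1+n b≤n)) ⟩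
  suc (a + m) * suc (suc n)               ≤⟨ ℕ.*-monoˡ-≤ (suc (suc n)) lt ⟩
  (b + l) * suc (suc n)                   ≡⟨ lemma n b l ⟨
  b + (b * suc n + l * suc (suc n))       ∎)
  where
  open ℕ.≤-Reasoning
  lemma : ∀ n a m → a + (a * suc n + m * suc (suc n)) ≡ (a + m) * suc (suc n)
  lemma = solve-∀

-- Outcomes of weighings in an ordered abelian group

module _ {c ℓ₁ ℓ₂} (W : OrderedAbelianGroup c ℓ₁ ℓ₂) where
  open OrderedAbelianGroup W renaming (_+_ to _∙_; _<_ to _≺_)
  open AbelianGroup abelianGroup
    using (monoid; commutativeSemigroup; identityˡ; identityʳ; ∙-cong; ∙-congˡ; ∙-congʳ; comm; assoc)
    renaming (refl to ≈-refl; sym to ≈-sym; trans to ≈-trans; reflexive to ≈-reflexive)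
  open Algebra.Properties.CommutativeSemigroup commutativeSemigroup using (x∙yz≈y∙xz)
  open Algebra.Properties.Monoid.Mult monoid using (×-homo-+; ×-assocˡ; ×-congˡ) renaming (_×_ to _·_)

  strictTotalOrder : StrictTotalOrder c ℓ₁ ℓ₂
  strictTotalOrder = record { isStrictTotalOrder = isStrictTotalOrder }

  open StrictTotalOrder strictTotalOrder
    using (strictPartialOrder; <-respˡ-≈; <-respʳ-≈)
    renaming (trans to <-trans; irrefl to <-irrefl; asym to <-asym)
  open Relation.Binary.Reasoning.StrictPartialOrder strictPartialOrder

  +-monoˡ-< : ∀ z {x y} → x ≺ y → x ∙ z ≺ y ∙ z
  +-monoˡ-< z {x} {y} x<y = begin-strict
    x ∙ z ≈⟨ comm x z ⟩
    z ∙ x <⟨ +-monoʳ-< z x<y ⟩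
    z ∙ y ≈⟨ comm z y ⟩
    y ∙ z ∎

  ·-monoʳ-< : ∀ d {x y} → x ≺ y → suc d · x ≺ suc d · y
  ·-monoʳ-< zero    x<y = +-monoˡ-< 0# x<y
  ·-monoʳ-< (suc d) x<y = <-trans (+-monoˡ-< _ x<y) (+-monoʳ-< _ (·-monoʳ-< d x<y))

  0<suc· : ∀ d {x} → 0# ≺ x → 0# ≺ suc d · x
  0<suc· zero    {x} 0<x = <-respʳ-≈ (≈-sym (identityʳ x)) 0<x
  0<suc· (suc d) {x} 0<x = begin-strict
    0#            <⟨ 0<x ⟩
    x             ≈⟨ identityʳ x ⟨
    x ∙ 0#        <⟨ +-monoʳ-< x (0<suc· d 0<x) ⟩
    x ∙ suc d · x ∎

  ·-monoˡ-< : ∀ {x} → 0# ≺ x → k < l → k · x ≺ l · x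
  ·-monoˡ-< {k} {x = x} 0<x k<l with ℕ.m≤n⇒∃[o]m+o≡n k<l
  ... | d , refl = begin-strict
    k · x               ≈⟨ identityʳ _ ⟨
    k · x ∙ 0#          <⟨ +-monoʳ-< _ (0<suc· d 0<x) ⟩
    k · x ∙ suc d · x   ≈⟨ ×-homo-+ x k (suc d) ⟨
    (k + suc d) · x     ≈⟨ ×-congˡ (ℕ.+-suc k d) ⟩
    suc (k + d) · x     ∎

  -- The two sides differ in that `suc d` coins of weight `x` are replaced by as many of weight `y`.
  -- Fakes take the part of `y` when they are heavier and that of `x` when they are lighter.
  exchange-< : ∀ {x y} → x ≺ y → (a l d : ℕ) → a · y ∙ (l + suc d) · x ≺ (a + suc d) · y ∙ l · x
  exchange-< {x} {y} x<y a l d = begin-strict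
    a · y ∙ (l + suc d) · x         ≈⟨ ∙-congˡ (×-homo-+ x l (suc d)) ⟩
    a · y ∙ (l · x ∙ suc d · x)     <⟨ +-monoʳ-< _ (+-monoʳ-< _ (·-monoʳ-< d x<y)) ⟩
    a · y ∙ (l · x ∙ suc d · y)     ≈⟨ ∙-congˡ (comm _ _) ⟩
    a · y ∙ (suc d · y ∙ l · x)     ≈⟨ assoc _ _ _ ⟨
    (a · y ∙ suc d · y) ∙ l · x     ≈⟨ ∙-congʳ (×-homo-+ y a (suc d)) ⟨
    (a + suc d) · y ∙ l · x         ∎

  module _ {kind : FakeKind} (w : Weights W kind) where
    open Weights w

    load : ℕ → ℕ → Carrier
    load a m = a · fake ∙ m · normal

    panWeight≈load : (F S : Subset n) (extra : ℕ) →
                     panWeight W w F S extra ≈ load ∣ S ∩ F ∣ (∣ S ─ F ∣ + extra)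
    panWeight≈load []            []            extra = ≈-refl
    panWeight≈load (inside ∷ F)  (inside ∷ S)  extra =
      ≈-trans (assoc _ _ _) (≈-trans (∙-congˡ (panWeight≈load F S extra)) (≈-sym (assoc _ _ _)))
    panWeight≈load (outside ∷ F) (inside ∷ S)  extra =
      ≈-trans (assoc _ _ _) (≈-trans (∙-congˡ (panWeight≈load F S extra)) (x∙yz≈y∙xz _ _ _))
    panWeight≈load (inside ∷ F)  (outside ∷ S) extra =
      ≈-trans (∙-congʳ (identityˡ _)) (panWeight≈load F S extra)
    panWeight≈load (outside ∷ F) (outside ∷ S) extra =
      ≈-trans (∙-congʳ (identityˡ _)) (panWeight≈load F S extra)

    -- With equal numbers of coins, the surplus of fakes on one pan is matched by an equal surplus
    -- of normal coins on the other, so `exchange-<` applies. Phrasing the conclusion with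
    -- `FakeVsNormal` covers both kinds: the pan with more fakes relates to the other as a fake does
    -- to a normal coin.
    load-fakeVsNormal : ∀ {a b m l} → a < b → a + m ≡ b + l →
                        FakeVsNormal W kind (load b l) (load a m)
    load-fakeVsNormal {a} {b} {m} {l} a<b eq with ℕ.m≤n⇒∃[o]m+o≡n a<b
    ... | d , refl = go kind fakeVsNormal
      where
      b≡ : a + suc d ≡ suc a + d
      b≡ = ℕ.+-suc a d
      m≡ : l + suc d ≡ m
      m≡ = ℕ.+-cancelˡ-≡ a _ _ (sym (trans eq (shuffle a d l)))
        where
        shuffle : ∀ a d l → suc a + d + l ≡ a + (l + suc d)
        shuffle = solve-∀
      go : ∀ kind → FakeVsNormal W kind fake normal →
           FakeVsNormal W kind (load (suc a + d) l) (load a m)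
      go heavier normal<fake = begin-strict
        a · fake ∙ m · normal               ≈⟨ ∙-congˡ (×-congˡ m≡) ⟨
        a · fake ∙ (l + suc d) · normal     <⟨ exchange-< normal<fake a l d ⟩
        (a + suc d) · fake ∙ l · normal     ≈⟨ ∙-congʳ (×-congˡ b≡) ⟩
        (suc a + d) · fake ∙ l · normal     ∎
      go lighter fake<normal = begin-strict
        (suc a + d) · fake ∙ l · normal     ≈⟨ comm _ _ ⟩
        l · normal ∙ (suc a + d) · fake     ≈⟨ ∙-congˡ (×-congˡ b≡) ⟨
        l · normal ∙ (a + suc d) · fake     <⟨ exchange-< fake<normal l a d ⟩
        (l + suc d) · normal ∙ a · fake     ≈⟨ comm _ _ ⟩
        a · fake ∙ (l + suc d) · normal     ≈⟨ ∙-congˡ (×-congˡ m≡) ⟩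
        a · fake ∙ m · normal               ∎

    module _ (F : Subset n) (v : Weighing n) where
      open Weighing v

      leftLoad rightLoad : Carrier
      leftLoad  = load ∣ left ∩ F ∣ (∣ left ─ F ∣ + extraLeft)
      rightLoad = load ∣ right ∩ F ∣ (∣ right ─ F ∣ + extraRight)

      private
        wl≈ = panWeight≈load F left extraLeft
        wr≈ = panWeight≈load F right extraRight

      outcome-< : leftLoad ≺ rightLoad → outcome W w F v ≡ leftLighter
      outcome-< lt with compare (panWeight W w F left extraLeft) (panWeight W w F right extraRight)
      ... | tri< _ _ _  = refl
      ... | tri≈ _ eq _ = contradiction lt (<-irrefl (≈-trans (≈-sym wl≈) (≈-trans eq wr≈)))
      ... | tri> _ _ gt = contradiction lt (<-asym (<-respˡ-≈ wr≈ (<-respʳ-≈ wl≈ gt)))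

      outcome-> : rightLoad ≺ leftLoad → outcome W w F v ≡ leftHeavier
      outcome-> gt with compare (panWeight W w F left extraLeft) (panWeight W w F right extraRight)
      ... | tri> _ _ _  = refl
      ... | tri≈ _ eq _ = contradiction gt (<-irrefl (≈-trans (≈-sym wr≈) (≈-trans (≈-sym eq) wl≈)))
      ... | tri< lt _ _ = contradiction gt (<-asym (<-respʳ-≈ wr≈ (<-respˡ-≈ wl≈ lt)))

      outcome-≈ : leftLoad ≈ rightLoad → outcome W w F v ≡ balanced
      outcome-≈ eq with compare (panWeight W w F left extraLeft) (panWeight W w F right extraRight)
      ... | tri≈ _ _ _     = refl
      ... | tri< _ wl≉wr _ = contradiction (≈-trans wl≈ (≈-trans eq (≈-sym wr≈))) wl≉wr
      ... | tri> _ wl≉wr _ = contradiction (≈-trans wl≈ (≈-trans eq (≈-sym wr≈))) wl≉wr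

  -- The names `fewer` and `more` refer to the fakes on the left pan, and `even` to the numbers of
  -- coins.
  outcome-fewer : ∀ kind (w : Weights W kind) (F : Subset n) v →
                  FakeVsNormal W kind (rightLoad w F v) (leftLoad w F v) →
                  outcome W w F v ≡ perceived kind leftLighter
  outcome-fewer heavier w F v = outcome-< w F v
  outcome-fewer lighter w F v = outcome-> w F v

  outcome-more : ∀ kind (w : Weights W kind) (F : Subset n) v →
                 FakeVsNormal W kind (leftLoad w F v) (rightLoad w F v) →
                 outcome W w F v ≡ perceived kind leftHeavier
  outcome-more heavier w F v = outcome-> w F v
  outcome-more lighter w F v = outcome-< w F v

  -- Unequal numbers of fakes decide the weighing by `load-fakeVsNormal`. Equal numbers of fakes
  -- leave equal numbers of normal coins as well, hence equal loads. In no case do the values of the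
  -- weights matter.
  outcome-even : ∀ kind (w : Weights W kind) (F : Subset n) v → leftCount v ≡ rightCount v →
                 outcome W w F v ≡
                 perceived kind (compareLoads ∣ Weighing.left v ∩ F ∣ ∣ Weighing.right v ∩ F ∣)
  outcome-even {n} kind w F v even = go
    where
    open Weighing v
    a b a′ b′ : ℕ
    a = ∣ left ∩ F ∣
    b = ∣ right ∩ F ∣
    a′ = ∣ left ─ F ∣ + extraLeft
    b′ = ∣ right ─ F ∣ + extraRight
    eq : a + a′ ≡ b + b′
    eq = trans (sym (panCount left F extraLeft)) (trans even (panCount right F extraRight))
    go : outcome W w F v ≡ perceived kind (compareLoads a b)
    go with <-cmp a b
    ... | tri< a<b _ _ rewrite compareLoads-< a<b =
      outcome-fewer kind w F v (load-fakeVsNormal w a<b eq)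
    ... | tri> _ _ b<a rewrite compareLoads-> b<a =
      outcome-more kind w F v (load-fakeVsNormal w b<a (sym eq))
    ... | tri≈ _ a≡b _ rewrite compareLoads-≡ a≡b | perceived-balanced kind =
      outcome-≈ w F v (≈-reflexive (cong₂ (load w) a≡b
        (ℕ.+-cancelˡ-≡ b a′ b′ (trans (cong (_+ a′) (sym a≡b)) eq))))

  outcome-placement : ∀ kind (w : Weights W kind) (F : Subset n) (v : Weighing n) →
                      leftCount v ≡ rightCount v →
                      outcome W w F v ≡
                      perceived kind (tip (placement (Weighing.left v) (Weighing.right v)) F)
  outcome-placement kind w F v even
    rewrite fakesLeft-leftPan (placement (Weighing.left v) (Weighing.right v)) F
          | fakesRight-rightPan (placement (Weighing.left v) (Weighing.right v)) F
          | leftPan-placement (Weighing.left v) (Weighing.right v)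
          | rightPan-placement (Weighing.left v) (Weighing.right v) (Weighing.disjoint v) =
    outcome-even kind w F v even

  outcome-weighing : ∀ kind (w : Weights W kind) (F : Subset n) p →
                     outcome W w F (weighing p) ≡ perceived kind (tip p F)
  outcome-weighing kind w F p
    rewrite fakesLeft-leftPan p F | fakesRight-rightPan p F =
    outcome-even kind w F (weighing p) (ℕ.+-comm ∣ leftPan p ∣ ∣ rightPan p ∣)

  result-strategy : ∀ kind (w : Weights W kind) (F : Subset n) (s : Plan n k) →
                    result W w F (strategy kind s) ≡ identify s F
  result-strategy kind w F (answer G)  = refl
  result-strategy kind w F (weigh p s)
    rewrite outcome-weighing kind w F p | perceived-involutive kind (tip p F) =
    result-strategy kind w F (s (tip p F))

  -- The adversary's weights in an arbitrary ordered group

  unitWeights : ℕ → ∀ kind → Weights W kind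
  unitWeights n kind = record
    { normal       = normalUnits n kind · 1#
    ; fake         = fakeUnits n kind · 1#
    ; 0<normal     = 0<normal kind
    ; 0<fake       = 0<fake kind
    ; fakeVsNormal = fakeVsNormal kind
    }
    where
    0<normal : ∀ kind → 0# ≺ normalUnits n kind · 1#
    0<normal heavier = 0<suc· n 0<1
    0<normal lighter = 0<suc· (suc n) 0<1
    0<fake : ∀ kind → 0# ≺ fakeUnits n kind · 1#
    0<fake heavier = 0<suc· (suc n) 0<1
    0<fake lighter = 0<suc· n 0<1
    fakeVsNormal : ∀ kind → FakeVsNormal W kind (fakeUnits n kind · 1#) (normalUnits n kind · 1#)
    fakeVsNormal heavier = ·-monoˡ-< 0<1 (ℕ.n<1+n (suc n))
    fakeVsNormal lighter = ·-monoˡ-< 0<1 (ℕ.n<1+n (suc n))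

  unitLoad-< : ∀ n kind {a b m l : ℕ} → a ≤ n → b ≤ n → a + m < b + l →
               load (unitWeights n kind) a m ≺ load (unitWeights n kind) b l
  unitLoad-< n kind {a} {b} {m} {l} a≤n b≤n lt = begin-strict
    load (unitWeights n kind) a m                         ≈⟨ units a m ⟩
    (a * fakeUnits n kind + m * normalUnits n kind) · 1#
      <⟨ ·-monoˡ-< 0<1 (units-< n kind a≤n b≤n lt) ⟩
    (b * fakeUnits n kind + l * normalUnits n kind) · 1#  ≈⟨ units b l ⟨
    load (unitWeights n kind) b l                         ∎
    where
    units : ∀ a m → load (unitWeights n kind) a m ≈
                    (a * fakeUnits n kind + m * normalUnits n kind) · 1#
    units a m = ≈-trans (∙-cong (×-assocˡ 1# a _) (×-assocˡ 1# m _))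
                        (≈-sym (×-homo-+ 1# (a * fakeUnits n kind) _))

  outcome-unit-< : ∀ kind (F : Subset n) (v : Weighing n) → leftCount v < rightCount v →
                   outcome W (unitWeights n kind) F v ≡ leftLighter
  outcome-unit-< {n} kind F v lt = outcome-< (unitWeights n kind) F v
    (unitLoad-< n kind (∣p∣≤n (left ∩ F)) (∣p∣≤n (right ∩ F))
      (subst₂ _<_ (panCount left F extraLeft) (panCount right F extraRight) lt))
    where open Weighing v

  outcome-unit-> : ∀ kind (F : Subset n) (v : Weighing n) → rightCount v < leftCount v →
                   outcome W (unitWeights n kind) F v ≡ leftHeavier
  outcome-unit-> {n} kind F v gt = outcome-> (unitWeights n kind) F v
    (unitLoad-< n kind (∣p∣≤n (right ∩ F)) (∣p∣≤n (left ∩ F))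
      (subst₂ _<_ (panCount right F extraRight) (panCount left F extraLeft) gt))
    where open Weighing v

  -- Both sides follow the same path: a skipped weighing has the outcome that `plan` presumes, by
  -- `outcome-unit-<` and `outcome-unit->`, and a kept one agrees with its placement by
  -- `outcome-placement`.
  identify-plan : ∀ kind (F : Subset n) (s : Strategy n k) →
                  identify (plan kind s) F ≡ result W (unitWeights n kind) F s
  identify-plan kind F (answer G) = refl
  identify-plan {n} kind F (weigh v s) with <-cmp (leftCount v) (rightCount v)
  ... | tri< lt _ _ rewrite outcome-unit-< kind F v lt =
    trans (identify-weaken (plan kind (s leftLighter)) F) (identify-plan kind F (s leftLighter))
  ... | tri> _ _ gt rewrite outcome-unit-> kind F v gt =
    trans (identify-weaken (plan kind (s leftHeavier)) F) (identify-plan kind F (s leftHeavier))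
  ... | tri≈ _ even _ rewrite outcome-placement kind (unitWeights n kind) F v even =
    identify-plan kind F (s (perceived kind (tip (placement (Weighing.left v) (Weighing.right v)) F)))

  solvable⇒sortable : ∀ kind → Solvable n k → Sortable W kind n k
  solvable⇒sortable kind (s , sorts) =
    strategy kind s , λ F w → trans (result-strategy kind w F s) (sorts F)

  -- A sorting strategy copes with all weights, so it may be tested against the adversary's alone.
  sortable⇒solvable : ∀ kind → Sortable W kind n k → Solvable n k
  sortable⇒solvable {n} kind (s , sorts) =
    plan kind s , λ F → trans (identify-plan kind F s) (sorts F (unitWeights n kind))

-- Plans for few coins

-- A guide prescribes the first weighings of a plan, the rest of which is to
-- be found by search.
data Guide (n : ℕ) : Set where
  auto : Guide n
  try  : Placement n → (heavy light even : Guide n) → Guide n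

-- The placements of a coins of S on the left pan and b on the right one.
placements : ℕ → ℕ → Subset n → List (Placement n)
placements zero    zero    _             = idle ∷ []
placements (suc _) _       []            = []
placements zero    (suc _) []            = []
placements a       b       (outside ∷ S) = List.map (aside ∷_) (placements a b S)
placements zero    (suc b) (inside ∷ S)  =
  List.map (onRight ∷_) (placements zero b S) List.++ List.map (aside ∷_) (placements zero (suc b) S)
placements (suc a) zero    (inside ∷ S)  =
  List.map (onLeft ∷_) (placements a zero S) List.++ List.map (aside ∷_) (placements (suc a) zero S)
placements (suc a) (suc b) (inside ∷ S)  =
  List.map (onLeft ∷_) (placements a (suc b) S) List.++ List.map (onRight ∷_) (placements (suc a) b S)
    List.++ List.map (aside ∷_) (placements (suc a) (suc b) S)

-- The coins in some but not all of the remaining sets are those still in doubt. Only weighings of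
-- one such coin against a supply coin or against another such coin are tried, which keeps the
-- search short.
candidates : List (Subset n) → List (Placement n)
candidates Fs = placements 1 0 undecided List.++ placements 1 1 undecided
  where
  undecided : Subset _
  undecided = ⋃ Fs ─ ⋂ Fs

-- Labelling first and then selecting computes each outcome once rather than
-- three times.
Labelled : ℕ → Set
Labelled n = List (Outcome × Subset n)

label : Placement n → List (Subset n) → Labelled n
label p = List.map λ F → tip p F , F

select : Labelled n → Outcome → List (Subset n)
select xs o = List.map proj₂ (filter (λ x → proj₁ x ≟ₒ o) xs)

∈-select : (p : Placement n) {Fs : List (Subset n)} {F : Subset n} →
           F ∈ Fs → F ∈ select (label p Fs) (tip p F)
∈-select p {F = F} F∈ = ∈-map⁺ proj₂
  (∈-filter⁺ (λ x → proj₁ x ≟ₒ tip p F) (∈-map⁺ (λ F → tip p F , F) F∈) refl)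

-- A success carries its own proof of correctness, so neither the guides nor the choice of
-- candidates has to be trusted. The value `nothing` refutes nothing.
search   : Guide n → ∀ k (Fs : List (Subset n)) → Maybe (Distinguishable k Fs)
searchBy : List (Placement n) → ∀ k (Fs : List (Subset n)) → Maybe (Distinguishable (suc k) Fs)
after    : (Outcome → Guide n) → ∀ k (xs : Labelled n) →
           Maybe (∀ o → Distinguishable k (select xs o))

search g             k       []       = just (answer (Vec.replicate _ outside) , [])
search g             k       (F ∷ []) = just (answer F , refl ∷ [])
search g             zero    Fs       = nothing
search (try p h l e) (suc k) Fs       = Maybe.map
  (weigh-distinguishes p (select (label p Fs)) (∈-select p))
  (after (λ { leftHeavier → h ; leftLighter → l ; balanced → e }) k (label p Fs))
search auto          (suc k) Fs       = searchBy (candidates Fs) k Fs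

searchBy []       k Fs = nothing
searchBy (p ∷ ps) k Fs with after (const auto) k (label p Fs)
... | just d  = just (weigh-distinguishes p (select (label p Fs)) (∈-select p) d)
... | nothing = searchBy ps k Fs

after g k xs with search (g leftHeavier) k (select xs leftHeavier)
... | nothing = nothing
... | just dh with search (g leftLighter) k (select xs leftLighter)
...   | nothing = nothing
...   | just dl with search (g balanced) k (select xs balanced)
...     | nothing = nothing
...     | just de = just λ { leftHeavier → dh ; leftLighter → dl ; balanced → de }

-- The coins are called a, b, c, …; those in upper case go on the left pan and
-- those in lower case on the right pan (97 is the code of the letter a).
parsePlacement : List Char → Placement n
parsePlacement []       = idle
parsePlacement (c ∷ cs) = put (Char.toℕ (Char.toLower c) ∸ 97) (parsePlacement cs)
  where
  put : ∀ {n} → ℕ → Placement n → Placement n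
  put _       []      = []
  put zero    (_ ∷ p) = (if Char.isLower c then onRight else onLeft) ∷ p
  put (suc i) (x ∷ p) = x ∷ put i p

-- A guide of depth d is written in preorder, with the branches in the order
-- left heavier, left lighter, balanced; a dot stands for auto.
parse : ℕ → List String → Guide n × List String
parse zero    ws         = auto , ws
parse (suc d) []         = auto , []
parse (suc d) ("." ∷ ws) = auto , ws
parse (suc d) (w ∷ ws)   =
  let h , ws₁ = parse d ws
      l , ws₂ = parse d ws₁
      e , ws₃ = parse d ws₂
  in try (parsePlacement (toList w)) h l e , ws₃

-- Only the last weighing is left to the search.
guided : ∀ n k → List String → Maybe (Solvable n k)
guided n k rows = Maybe.map distinguishable⇒solvable
  (search (proj₁ (parse (k ∸ 1) (List.concatMap words rows))) k (allSubsets n))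

-- Coin a is weighed against b. If they differ, both are known, and c and d are tested singly. If
-- they agree, c and d against a and b leaves at most three candidates, which one weighing
-- separates. As in the plans below, `from-just` yields a proof because the search evaluates to
-- `just`.
solvable-4-3 : Solvable 4 3
solvable-4-3 = from-just (guided 4 3 (
  "Ab c c CDab" ∷
  []))

solvable-6-4 : Solvable 6 4
solvable-6-4 = from-just (guided 6 4 (
  "ABcd CEdf Ec Fd EFa CEdf Fd Ec Daf Cd ACbef ADbef EFab" ∷
  []))

solvable-9-6 : Solvable 9 6
solvable-9-6 = from-just (guided 9 6 (
  "ABcd e . CFGdhi FHgi AEbch AEbci FGcde FHgi AEbdf AEbdg HIcde DHci Hdf Fch Efh" ∷
  "CFGdhi FHgi AFbch AGbci FGacd FHgi AHbdf AIbdg HIacd DHci Hdf Fch FHa e . CFGdhi" ∷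
  "FHgi ACbdg ACbdf HIEcd FHgi ADbci ADbch FGEcd DHci FDch HCdf Efh CFGdhi FHgi ACbdg" ∷
  "ACbdf GHIabc FHgi ADbci ADbch FGIabd DHci FDch HCdf Dah Cd EFgh Efg i EGai ACbhi Geh" ∷
  "i EGai ACbfi Gh EIaf EIaf EFai EFgh Efg i EGai ADbhi Geh i EGai ADbfi Gh EIaf EIaf" ∷
  "EFai EFgh Efg i EGai HIab Geh i EGai FIab Gh EIab EIab EFai" ∷
  []))

-- The source of the ratio 7/11. There are 2048 sets of fakes and only 2187 sequences of seven
-- outcomes, so the plan has little slack.
solvable-11-7 : Solvable 11 7
solvable-11-7 = from-just (guided 11 7 (
  "ABCdef DGHeij GHIabf AIbek FGdjk BCIKag KAij IKh CJbi DKabj DFGBachi EKdj Gdi HJeg" ∷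
  "Baej CIah FGehk FHKcd CJFab Gfij DIJc GHdj CFKaeh CFDab HAceik Fd GKcj GKcj Kh" ∷
  "FIKdej DIJc GKchj FCak Ab JKeg Ab HJck GJcde DKcj Gh Ab Gh GIJabf AIbek HKfg CDEa" ∷
  "CEak KIdej IKcde FGch JKhc Cagh Jeg HIdj Abdh CGai FIdjk FJKce CHFab Ifgh EGHc IJeh" ∷
  "CFKadj CFEab JAcdgk Fe IKch IKch Kj FGKdeh EGHc IKchj FCak Ab HKdi Ab HJck HIced" ∷
  "EKch Ij Ab Ij IKgj FKdi FIae BGch EHFbc Kae HJa Hbd Kegf Ibek Keh Abd AFbe HKabc" ∷
  "FIek HIaf BFcd BHcd Db Edk AHbc AGbcd Kaf Hdk AHbce AFbd JGabc HJaf Bad GIcf Cbe Hdi" ∷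
  "FIbe Cbd GKcf CDEa FJb Fdi GIac Geh DGHeij GIJabf FIKdj IJeh CHJad DIcfe Gcd FGJekd" ∷
  "IDceh CHabe AGbch Fe DIcf DIce Djk AIKbe Kegj HId EKdh HJcgk HJgk EFGbd CEHadk Dacg" ∷
  "EGd HIJd JKh Fce FGKdeh HKdi HJck Ab JFced GKcij GHKefd FIcg FIDceh EKch Ab Ij Ij" ∷
  "GHIabf FGKeh GHdj CHJae EGcfd Ice FHIdke GEcdj CJabd AIbcj Fd EGcf EGcd Ehk AIKbe" ∷
  "JKdi GHJaci JAbcd EGdh FGKdj JKbc BCafi Ihk Edi Kj GHJe Fcd FIKdej JKeg HJck Ab" ∷
  "HFcde IKcgh IJKdfe FGci FGEcdj DKcj Ab Gh Gh IKgj FIek Kae Fdj BCa Fah Daf Gh Hb Ibc" ∷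
  "Hag Dbf Ba EGbk FKdi Edk AHbc Fabc Fae Eaf Gh Dbe Dbci Gah BEcd BCa GIf HJaf Ebf" ∷
  "GEdj CKbe IDeh BCa Ki JKi GFde Ebj FHci Gae Fbg DGeh Ab Feh GIcj JAcik GAijk KAgj i" ∷
  ". JKce JKce IJcg IAgjk KAcf Kcf Feh GIcj JBcik GBijk KBgj i . JKce JKce IJcg IBgjk" ∷
  "KBcf Kcf IJKfgh GIcd FGei JKid FHc HIce JKi Fdi GJdh GHfi HJad CJa If Ab GHe FIej" ∷
  "JAcik IAcjk KAfj i . JKcf JKcf DIfj IAcjk JAcik Jfk GHe FIej JBcik IBcjk KBfj i ." ∷
  "JKcf JKcf DIfj IBcjk JBcik Jfk IJKfgh HIce FHdi JKie FGc GIcd JKi Fei HJeg GHfi GJae" ∷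
  "CJa If Fe Gd AIbj JKci IKcj Jbk AIbj IKcj JKci JKb AIbj JKci IKcj Jbk Gd AIbj JKci" ∷
  "IKcj Jbk AIbj IKcj JKci JKb AIbj IKcj JKci JKb IJKegh HIagj Kbj GKbe Kgi IJKdh Ij" ∷
  "GIJak He Hg Ij Ij Ga" ∷
  []))

-- Composing plans for 11 and 3 coins would take 7 + 3 weighings, whereas the ceiling of 98/11 is 9.
solvable-14-9 : Solvable 14 9
solvable-14-9 = from-just (guided 14 9 (
  "ABcd EFgh Efg i . j . CKLdmn KMln AEbcm AEbcn KLcde KMln AEbdk AEbdl MNcde DMcn Mdk" ∷
  "Kcm Ekm CKLdmn KMln AEbcm AEbcn KLcde KMln AEbdk AEbdl MNcde DMcn Mdk Kcm Ekm j ." ∷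
  "CKLdmn KMln AEbcm AEbcn KLcde KMln AEbdk AEbdl MNcde DMcn Mdk Kcm Ekm CKLdmn KMln" ∷
  "AEbcm AEbcn KLcde KMln AEbdk AEbdl MNcde DMcn Mdk Kcm Ekm IJkl MNeg Mn IKLcdj Kl Cd" ∷
  "Cd IKLcdj Kl Cd Cd IKLcdj Kl Cd Cd Mn IKLcdj Kl Cd Cd IKLcdj Kl Cd Cd IKLcdj Kl Cd" ∷
  "Cd e . IKLcdj Kl Cd Cd IKLcdj Kl Cd Cd MNeg Mn IJKcdl Ij Cd Cd IJKcdl Ij Cd Cd" ∷
  "IJKcdl Ij Cd Cd Mn IJKcdl Ij Cd Cd IJKcdl Ij Cd Cd IJKcdl Ij Cd Cd e . IJKcdl Ij Cd" ∷
  "Cd IJKcdl Ij Cd Cd Kl CMNdei IMen ANbc AFbce ANbj IMen AFbdm AEbdn ANbj JMin NFem" ∷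
  "Nem Ie CMNdei IMen ANbc AFbce ANbj IMen AFbdm AEbdn ANbj JMin NFem Nem Ie CMNdei" ∷
  "IMen AFbci AFbce DIJc IMen AFbdm AEbdn EIcdf MNij Edm Mce Fei HIjk Hij l . CMdn Mc" ∷
  "Nd Emn CMdn Mc Nd Emn CLMdhn LNhm AEbcn AEbch DHJc LNhm AEbdl AEbdm HNcde LNhj DLa" ∷
  "Mln Ehm CKLdmn KMln AEbcm AEbcn KLcde KMln AEbdk AEbdl MNcde DMcn Mdk Kcm Ekm Jhk l" ∷
  ". CMdn Mc Nd Emn CMdn Mc Nd Emn CLMdhn LNhm AEbcn AEbch DHJc LNhm AEbdl AEbdm HNcde" ∷
  "LNhj DLa Mln Ehm CILdmn IMln AEbcm AEbcn ILcde IMln AEbdi AEbdl MNcde DMcn Mdi Icm" ∷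
  "Eim Jk CLMdhn LNhm AEbcn ALbc ALbi LNhm AEbdl AEbdm ALbi ILhn Ndm Mcn Mh CLMdhn LNhm" ∷
  "AEbcn ALbc ALbi LNhm AEbdl AEbdm ALbi ILhn Ndm Mcn Mh CLMdhn LNhm AEbcn AEbch DHIc" ∷
  "LNhm AEbdl AEbdm HNcde LNhi DLa Mln Ehm Geh i . j . CKLdmn KMln AGbcm AGbcn KLcdg" ∷
  "KMln AGbdk AGbdl MNcdg DMcn Mdk Kcm Gkm CKLdmn KMln AGbcm AGbcn KLcdg KMln AGbdk" ∷
  "AGbdl MNcdg DMcn Mdk Kcm Gkm j . CKLdmn KMln AGbcm AGbcn KLcdg KMln AGbdk AGbdl" ∷
  "MNcdg DMcn Mdk Kcm Gkm CKLdmn KMln AGbcm AGbcn KLcdg KMln AGbdk AGbdl MNcdg DMcn Mdk" ∷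
  "Kcm Gkm IJkl MNeg Mn IKLcdj Kl Cd Cd IKLcdj Kl Cd Cd IKLcdj Kl Cd Cd Mn IKLcdj Kl Cd" ∷
  "Cd IKLcdj Kl Cd Cd IKLcdj Kl Cd Cd e . IKLcdj Kl Cd Cd IKLcdj Kl Cd Cd MNeg Mn" ∷
  "IJKcdl Ij Cd Cd IJKcdl Ij Cd Cd IJKcdl Ij Cd Cd Mn IJKcdl Ij Cd Cd IJKcdl Ij Cd Cd" ∷
  "IJKcdl Ij Cd Cd e . IJKcdl Ij Cd Cd IJKcdl Ij Cd Cd Kl CMNdei IMen ANbc AHbce ANbj" ∷
  "IMen AHbdm AEbdn ANbj JMin NHem Nem Ie CMNdei IMen ANbc AHbce ANbj IMen AHbdm AEbdn" ∷
  "ANbj JMin NHem Nem Ie CMNdei IMen AHbci AHbce DIJc IMen AHbdm AEbdn EIcdh MNij Edm" ∷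
  "Mce Hei FIjk Fij l . CMdn Mc Nd Fmn CMdn Mc Nd Fmn CLMdfn LNfm AGbcn AGbcf DFJc LNfm" ∷
  "AGbdl AFbdm FNcdg LNfj DLa Mln Gfm CKLdmn KMln AFbcm AFbcn KLcdf KMln AFbdk AFbdl" ∷
  "MNcdf DMcn Mdk Kcm Fkm Jfk l . CMdn Mc Nd Gmn CMdn Mc Nd Gmn CLMdfn LNfm AGbcn AGbcf" ∷
  "DFJc LNfm AGbdl AFbdm FNcdg LNfj DLa Mln Gfm CILdmn IMln AGbcm AGbcn ILcdg IMln" ∷
  "AGbdi AGbdl MNcdg DMcn Mdi Icm Gim Jk CLMdfn LNfm AGbcn ALbc ALbi LNfm AGbdl AFbdm" ∷
  "ALbi ILfn Ndm Mcn Mf CLMdfn LNfm AGbcn ALbc ALbi LNfm AGbdl AFbdm ALbi ILfn Ndm Mcn" ∷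
  "Mf CLMdfn LNfm AGbcn AGbcf DFIc LNfm AGbdl AFbdm FNcdg LNfi DLa Mln Gfm Gh IJkl EMfn" ∷
  "Emn IKLcdj Kl Cd Cd IKLcdj Kl Cd Cd IKLcdj Kl Cd Cd Fmn IKLcdj Kl Cd Cd IKLcdj Kl Cd" ∷
  "Cd IKLcdj Kl Cd Cd f . IKLcdj Kl Cd Cd IKLcdj Kl Cd Cd EMfn Emn IJKcdl Ij Cd Cd" ∷
  "IJKcdl Ij Cd Cd IJKcdl Ij Cd Cd Fmn IJKcdl Ij Cd Cd IJKcdl Ij Cd Cd IJKcdl Ij Cd Cd" ∷
  "f . IJKcdl Ij Cd Cd IJKcdl Ij Cd Cd Kl CMNdei MNfj AJbc AMbc AMbn JMfn AEbdm AGbdn" ∷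
  "AMbj JMin Mfn Nem Jf CMNdei MNfj AJbc AMbc AMbn JMfn AEbdm AGbdn AMbj JMin Mfn Nem" ∷
  "Jf CMNdei IMen AFbci AMbc AMbf IMen AGbdm AEbdn AMbf MNij Edm Mce If IJkl EMfn Emn" ∷
  "IKLcdj Kl Cd Cd IKLcdj Kl Cd Cd IKLcdj Kl Cd Cd Fmn IKLcdj Kl Cd Cd IKLcdj Kl Cd Cd" ∷
  "IKLcdj Kl Cd Cd f . IKLcdj Kl Cd Cd IKLcdj Kl Cd Cd EMfn Emn IJKcdl Ij Cd Cd IJKcdl" ∷
  "Ij Cd Cd IJKcdl Ij Cd Cd Fmn IJKcdl Ij Cd Cd IJKcdl Ij Cd Cd IJKcdl Ij Cd Cd f ." ∷
  "IJKcdl Ij Cd Cd IJKcdl Ij Cd Cd Kl CMNdei MNfj AJbc AMbc AMbn JMfn AEbdm AHbdn AMbj" ∷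
  "JMin Mfn Nem Jf CMNdei MNfj AJbc AMbc AMbn JMfn AEbdm AHbdn AMbj JMin Mfn Nem Jf" ∷
  "CMNdei IMen AFbci AMbc AMbf IMen AHbdm AEbdn AMbf MNij Edm Mce If IJkl MNef Mn" ∷
  "IKLcdj Kl Cd Cd IKLcdj Kl Cd Cd IKLcdj Kl Cd Cd Mn IKLcdj Kl Cd Cd IKLcdj Kl Cd Cd" ∷
  "IKLcdj Kl Cd Cd e . IKLcdj Kl Cd Cd IKLcdj Kl Cd Cd MNef Mn IJKcdl Ij Cd Cd IJKcdl" ∷
  "Ij Cd Cd IJKcdl Ij Cd Cd Mn IJKcdl Ij Cd Cd IJKcdl Ij Cd Cd IJKcdl Ij Cd Cd e ." ∷
  "IJKcdl Ij Cd Cd IJKcdl Ij Cd Cd Kl CMNdei IMen ANbc AJbce ANbj IMen AIbdm AEbdn ANbj" ∷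
  "JMin NJem Nem Ie CMNdei IMen ANbc AJbce ANbj IMen AIbdm AEbdn ANbj JMin NJem Nem Ie" ∷
  "CMNdei IMen AMbci ANbce DIJc IMen AIbdm AEbdn EIacd MNij Edm Mce EIa EFgh Efg i . j" ∷
  ". CKLdmn KMln ACbdl ACbdk MNEcd KMln ADbcn ADbcm KLEcd DMcn KDcm MCdk Ekm CKLdmn" ∷
  "KMln ACbdl ACbdk MNEcd KMln ADbcn ADbcm KLEcd DMcn KDcm MCdk Ekm j . CKLdmn KMln" ∷
  "ACbdl ACbdk MNEcd KMln ADbcn ADbcm KLEcd DMcn KDcm MCdk Ekm CKLdmn KMln ACbdl ACbdk" ∷
  "MNEcd KMln ADbcn ADbcm KLEcd DMcn KDcm MCdk Ekm IJkl MNeg Mn IJKcdl Cd Ij Cd IJKcdl" ∷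
  "Cd Ij Cd IJKcdl Cd Ij Cd Mn IJKcdl Cd Ij Cd IJKcdl Cd Ij Cd IJKcdl Cd Ij Cd e ." ∷
  "IJKcdl Cd Ij Cd IJKcdl Cd Ij Cd MNeg Mn IKLcdj Cd Kl Cd IKLcdj Cd Kl Cd IKLcdj Cd Kl" ∷
  "Cd Mn IKLcdj Cd Kl Cd IKLcdj Cd Kl Cd IKLcdj Cd Kl Cd e . IKLcdj Cd Kl Cd IKLcdj Cd" ∷
  "Kl Cd Kl CMNdei IMen ACbdn ACbdm ANbj IMen ADbce ANbc ANbj JMin Cam Nem Ie CMNdei" ∷
  "IMen ACbdn ACbdm ANbj IMen ADbce ANbc ANbj JMin Cam Nem Ie CMNdei IMen ACbdn ACbdm" ∷
  "DIJc IMen ADbce ADbci MNFcd MNij MDce ECdm Fei HIjk Hij l . CMdn Nd Mc Emn CMdn Nd" ∷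
  "Mc Emn CLMdhn LNhm ACbdm ACbdl DHJc LNhm ADbch ADbcn LMEcd LNhj MEln Mln Ehm CKLdmn" ∷
  "KMln ACbdl ACbdk MNEcd KMln ADbcn ADbcm KLEcd DMcn KDcm MCdk Ekm Jhk l . CMdn Nd Mc" ∷
  "Emn CMdn Nd Mc Emn CLMdhn LNhm ACbdm ACbdl DHJc LNhm ADbch ADbcn LMEcd LNhj MEln Mln" ∷
  "Ehm CILdmn IMln ACbdl ACbdi MNEcd IMln ADbcn ADbcm ILEcd DMcn IDcm MCdi Eim Jk" ∷
  "CLMdhn LNhm ACbdm ACbdl ALbi LNhm ALbc ADbcn ALbi ILhn LMc NCdm Mh CLMdhn LNhm ACbdm" ∷
  "ACbdl ALbi LNhm ALbc ADbcn ALbi ILhn LMc NCdm Mh CLMdhn LNhm ACbdm ACbdl DHIc LNhm" ∷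
  "ADbch ADbcn LMEcd LNhi MEln Mln Ehm Geh i . j . CKLdmn KMln ACbdl ACbdk MNGcd KMln" ∷
  "ADbcn ADbcm KLGcd DMcn KDcm MCdk Gkm CKLdmn KMln ACbdl ACbdk MNGcd KMln ADbcn ADbcm" ∷
  "KLGcd DMcn KDcm MCdk Gkm j . CKLdmn KMln ACbdl ACbdk MNGcd KMln ADbcn ADbcm KLGcd" ∷
  "DMcn KDcm MCdk Gkm CKLdmn KMln ACbdl ACbdk MNGcd KMln ADbcn ADbcm KLGcd DMcn KDcm" ∷
  "MCdk Gkm IJkl MNeg Mn IJKcdl Cd Ij Cd IJKcdl Cd Ij Cd IJKcdl Cd Ij Cd Mn IJKcdl Cd" ∷
  "Ij Cd IJKcdl Cd Ij Cd IJKcdl Cd Ij Cd e . IJKcdl Cd Ij Cd IJKcdl Cd Ij Cd MNeg Mn" ∷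
  "IKLcdj Cd Kl Cd IKLcdj Cd Kl Cd IKLcdj Cd Kl Cd Mn IKLcdj Cd Kl Cd IKLcdj Cd Kl Cd" ∷
  "IKLcdj Cd Kl Cd e . IKLcdj Cd Kl Cd IKLcdj Cd Kl Cd Kl CMNdei IMen ACbdn ACbdm ANbj" ∷
  "IMen ADbce ANbc ANbj JMin Cam Nem Ie CMNdei IMen ACbdn ACbdm ANbj IMen ADbce ANbc" ∷
  "ANbj JMin Cam Nem Ie CMNdei IMen ACbdn ACbdm DIJc IMen ADbce ADbci MNHcd MNij MDce" ∷
  "ECdm Hei FIjk Fij l . CMdn Nd Mc Fmn CMdn Nd Mc Fmn CLMdfn LNfm ACbdm ACbdl DFJc" ∷
  "LNfm ADbcf ADbcn LMGcd LNfj MGln Mln Gfm CKLdmn KMln ACbdl ACbdk MNFcd KMln ADbcn" ∷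
  "ADbcm KLFcd DMcn KDcm MCdk Fkm Jfk l . CMdn Nd Mc Gmn CMdn Nd Mc Gmn CLMdfn LNfm" ∷
  "ACbdm ACbdl DFJc LNfm ADbcf ADbcn LMGcd LNfj MGln Mln Gfm CILdmn IMln ACbdl ACbdi" ∷
  "MNGcd IMln ADbcn ADbcm ILGcd DMcn IDcm MCdi Gim Jk CLMdfn LNfm ACbdm ACbdl ALbi LNfm" ∷
  "ALbc ADbcn ALbi ILfn LMc NCdm Mf CLMdfn LNfm ACbdm ACbdl ALbi LNfm ALbc ADbcn ALbi" ∷
  "ILfn LMc NCdm Mf CLMdfn LNfm ACbdm ACbdl DFIc LNfm ADbcf ADbcn LMGcd LNfi MGln Mln" ∷
  "Gfm Gh IJkl EMfn Emn IJKcdl Cd Ij Cd IJKcdl Cd Ij Cd IJKcdl Cd Ij Cd Fmn IJKcdl Cd" ∷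
  "Ij Cd IJKcdl Cd Ij Cd IJKcdl Cd Ij Cd f . IJKcdl Cd Ij Cd IJKcdl Cd Ij Cd EMfn Emn" ∷
  "IKLcdj Cd Kl Cd IKLcdj Cd Kl Cd IKLcdj Cd Kl Cd Fmn IKLcdj Cd Kl Cd IKLcdj Cd Kl Cd" ∷
  "IKLcdj Cd Kl Cd f . IKLcdj Cd Kl Cd IKLcdj Cd Kl Cd Kl CMNdei JMfn ACbdn ACbdm AMbj" ∷
  "MNfj AMbc AJbc AMbn JMin Mfn Nem Jf CMNdei JMfn ACbdn ACbdm AMbj MNfj AMbc AJbc AMbn" ∷
  "JMin Mfn Nem Jf CMNdei IMen ACbdn ACbdm AMbf IMen AMbc ADbci AMbf MNij FMc ECdm If" ∷
  "IJkl EMfn Emn IJKcdl Cd Ij Cd IJKcdl Cd Ij Cd IJKcdl Cd Ij Cd Fmn IJKcdl Cd Ij Cd" ∷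
  "IJKcdl Cd Ij Cd IJKcdl Cd Ij Cd f . IJKcdl Cd Ij Cd IJKcdl Cd Ij Cd EMfn Emn IKLcdj" ∷
  "Cd Kl Cd IKLcdj Cd Kl Cd IKLcdj Cd Kl Cd Fmn IKLcdj Cd Kl Cd IKLcdj Cd Kl Cd IKLcdj" ∷
  "Cd Kl Cd f . IKLcdj Cd Kl Cd IKLcdj Cd Kl Cd Kl CMNdei JMfn ACbdn ACbdm AMbj MNfj" ∷
  "AMbc AJbc AMbn JMin Mfn Nem Jf CMNdei JMfn ACbdn ACbdm AMbj MNfj AMbc AJbc AMbn JMin" ∷
  "Mfn Nem Jf CMNdei IMen ACbdn ACbdm AMbf IMen AMbc ADbci AMbf MNij FMc ECdm If IJkl" ∷
  "MNef Mn IJKcdl Cd Ij Cd IJKcdl Cd Ij Cd IJKcdl Cd Ij Cd Mn IJKcdl Cd Ij Cd IJKcdl Cd" ∷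
  "Ij Cd IJKcdl Cd Ij Cd e . IJKcdl Cd Ij Cd IJKcdl Cd Ij Cd MNef Mn IKLcdj Cd Kl Cd" ∷
  "IKLcdj Cd Kl Cd IKLcdj Cd Kl Cd Mn IKLcdj Cd Kl Cd IKLcdj Cd Kl Cd IKLcdj Cd Kl Cd e" ∷
  ". IKLcdj Cd Kl Cd IKLcdj Cd Kl Cd Kl CMNdei IMen ACbdn ACbdm ANbj IMen ADbce ANbc" ∷
  "ANbj JMin Cam Nem Ie CMNdei IMen ACbdn ACbdm ANbj IMen ADbce ANbc ANbj JMin Cam Nem" ∷
  "Ie CMNdei IMen ACbdn ACbdm DIJc IMen ADbce ADbci IMNabd MNij MDce ECdm Dae Cd EFGhij" ∷
  "HKLimn KLMefj EMafi Kfhn GJe GNfc Lam GNfm EHNa GHec Gan Chm Cein Cein Gf AJbh Kl" ∷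
  "HMNAgj HMNAgj IKgn IBgj HKNgib NBklm EBfhn Kl Gai Gai Gbi GHNac JNbm Ef Kl JKil JKbl" ∷
  "Agj Ef GHb KNlm Ef Chm Lhi KMNefj EMafi GIej KLNeb Kal HKal Mejk BGLahi JMg GCfln" ∷
  "Cik HMbl HMbl Gf AJbi Mn IKLAgj IKLAgj HMgl HBgj ILMghb LBkmn EBfil Mn Gah Gah Gbh" ∷
  "GILac JLbk Ef Mn JMhn JMbn Agj Ef GIb LMkn Ef Cik Nhi JMin Kil EJaf Gfh GJf GHe" ∷
  "EIJaf FHIag GJf GHe KLa EFag EJfh EJfh Kl ICen EFag ACbfg EHa ICen EFag ACbfg EHa" ∷
  "Ihj EFag EFag Mj KLej Nai FKgl EFag FKgl KNal Fgi NCfg LNf KNal Ebij Cen JLf HKLimn" ∷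
  "KMNefj AJbi Hgj LAkmn ILMgh ILefm Mn Bgji Bgji HMgl Mn Hbg Hbg Hag EIafm GIfj Lak" ∷
  "KLNfb HKbl IKNa EGb LMh LMNjk Cik HMal HMal Ge GILac JMbn Ef Bgj GIbc JLbk Mn Ef" ∷
  "JMhn MNi Mek Jbe GMb KLMefj AJbh Igj NAklm HKNgi HNefk Kl Bgjh Bgjh IKgn Kl Ibg Ibg" ∷
  "Iag EIafm EHMbn Jgn KBhln HJac GNem GHf FKNehl Nag Chm KLNi KLNi Ge GHNac JKbl Ef" ∷
  "Bgj GHbc JNbm Kl Ef JKil KLh Kem Jbe GKb JMin Kl Ien ACbfg EFag EFag Ien ACbfg EFag" ∷
  "EFag Hei FJag EFag Ke KCil EIJafc Jae FGJa Hfj EJaf Jae Hgj Hfj Haj EKfg EJafg ECfkm" ∷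
  "KLej KNal Nfg Fgn Ifn Ian FGe EFag FGe KNal LNj Jbef Cel HKil Ef Jil Kg ACbmn ACbmn" ∷
  "ACbmn m . LNag LNag Cgk ACbmn ACbmn ACbmn Jil Kg ACbmn ACbmn ACbmn m . LNag LNag Cgk" ∷
  "ACbmn ACbmn ACbmn KLMajn IMgl Mej MNb JNg HMgk MNbc MCej Jgl MNkl Kei LNg Ng Ef KLi" ∷
  "Ji ACbmn ACbmn ACbmn m . GJan GJan Hj ACbmn ACbmn ACbmn KLi Ji ACbmn ACbmn ACbmn m ." ∷
  "GJan GJan Hj ACbmn ACbmn ACbmn KLMajn HMgk Mej MNb JNg IMgl MNbc MCej Jgk MNkl Leh" ∷
  "KNg Ng Ji Kh Ef ACbmn ACbmn ACbmn Ef ACbmn ACbmn ACbmn Ef ACbmn ACbmn ACbmn Kh Ef" ∷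
  "ACbmn ACbmn ACbmn Ef ACbmn ACbmn ACbmn Ef ACbmn ACbmn ACbmn KLMain MNbi KNh Bem Kh" ∷
  "MNbi Aem Khn Kh Ml NCei Nei Ia EFGhij HKLimn KLMefj EMafi Kfhn GJe GNfd Lam GNfm" ∷
  "EHNa GHed Gan Dhm Dein Dein Gf AJbh Kl HMNAgj HMNAgj IKgn IBgj HKNgib NBklm EBfhn Kl" ∷
  "Gai Gai Gbi GHNad JNbm Ef Kl JKil JKbl Agj Ef GHb KNlm Ef Dhm Lhi KMNefj EMafi GIej" ∷
  "KLNeb Kal HKal Mejk BGLahi JMg GDfln Dik HMbl HMbl Gf AJbi Mn IKLAgj IKLAgj HMgl" ∷
  "HBgj ILMghb LBkmn EBfil Mn Gah Gah Gbh GILad JLbk Ef Mn JMhn JMbn Agj Ef GIb LMkn Ef" ∷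
  "Dik Nhi JMin Kil EJaf Gfh GJf GHe EIJaf FHIag GJf GHe KLa EFag EJfh EJfh Kl IDen" ∷
  "EFag ADbfg EHa IDen EFag ADbfg EHa Ihj EFag EFag Mj KLej Nai FKgl EFag FKgl KNal Fgi" ∷
  "NDfg LNf KNal Ebij Den JLf HKLimn KMNefj AJbi Hgj LAkmn ILMgh ILefm Mn Bgji Bgji" ∷
  "HMgl Mn Hbg Hbg Hag EIafm GIfj Lak KLNfb HKbl IKNa EGb LMh LMNjk Dik HMal HMal Ge" ∷
  "GILad JMbn Ef Bgj GIbd JLbk Mn Ef JMhn MNi Mek Jbe GMb KLMefj AJbh Igj NAklm HKNgi" ∷
  "HNefk Kl Bgjh Bgjh IKgn Kl Ibg Ibg Iag EIafm EHMbn Jgn KBhln HJad GNem GHf FKNehl" ∷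
  "Nag Dhm KLNi KLNi Ge GHNad JKbl Ef Bgj GHbd JNbm Kl Ef JKil KLh Kem Jbe GKb JMin Kl" ∷
  "Ien ADbfg EFag EFag Ien ADbfg EFag EFag Hei FJag EFag Ke KDil EIJafd Jae FGJa Hfj" ∷
  "EJaf Jae Hgj Hfj Haj EKfg EJafg EDfkm KLej KNal Nfg Fgn Ifn Ian FGe EFag FGe KNal" ∷
  "LNj Jbef Del HKil Ef Jil Kg ADbmn ADbmn ADbmn m . LNag LNag Dgk ADbmn ADbmn ADbmn" ∷
  "Jil Kg ADbmn ADbmn ADbmn m . LNag LNag Dgk ADbmn ADbmn ADbmn KLMajn IMgl Mej MNb JNg" ∷
  "HMgk MNbd MDej Jgl MNkl Kei LNg Ng Ef KLi Ji ADbmn ADbmn ADbmn m . GJan GJan Hj" ∷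
  "ADbmn ADbmn ADbmn KLi Ji ADbmn ADbmn ADbmn m . GJan GJan Hj ADbmn ADbmn ADbmn KLMajn" ∷
  "HMgk Mej MNb JNg IMgl MNbd MDej Jgk MNkl Leh KNg Ng Ji Kh Ef ADbmn ADbmn ADbmn Ef" ∷
  "ADbmn ADbmn ADbmn Ef ADbmn ADbmn ADbmn Kh Ef ADbmn ADbmn ADbmn Ef ADbmn ADbmn ADbmn" ∷
  "Ef ADbmn ADbmn ADbmn KLMain MNbi KNh Bem Kh MNbi Aem Khn Kh Ml NDei Nei Ia EFGhij" ∷
  "HKLimn KLMefj HMab Ef KMhjl KMhjl Khin EJfi Aghj Aghi KLfma EKfl GINae GINaf ILfn" ∷
  "JKail GHajl Kjmn GNJef HMNg KLhn EILagj GJHef LEagim Jh GNak GNak La HMNab KNjlm" ∷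
  "NKghi MNabg JKgm GHemn Kl Nim Gf Gan Ef GIe Kl KMNefj IKab Ef KMijn KMijn Khil EJfh" ∷
  "Agij Aghi MNfka EMfn GHLae GHLaf HNfl JMahn GIajn Mjkl GLJef IKLg MNil EHNagj GJIef" ∷
  "NEaghk Ji GLam GLam Na IKLab LMjkn LMgih KLabg JMgk GIekl Mn Lhk Gf Gal Ef GHe Mn" ∷
  "JMin Kil EJaf HEgj FGab FGHak EIJaf JEafghi FGab FGHal KLa EFag EJfh EJfh Kl IKen" ∷
  "EFag FGab EHa ILen EFag FGab EHa Ihj EFag EFag Mj KLej Nai FKgl EFag FKgl KNal Fgi" ∷
  "NEfg LEfg KNal IJKae IJLa Fgj HKLimn KMNefj HMajn Megi LNk JMHabgl JLafm MNil GLMeh" ∷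
  "HNgji Kgh Ji HNgj HNgi Hlm IKab EJfim HEgil GJLehf ILgkh Ef LMNgj LMNgj Aegi Ef" ∷
  "HMgln HMgln LMNh HLMaik Labm Kgi ENfg KHgij EIaf JLgh ILgh ILgj Jim ENag Hgj Ef" ∷
  "KLMefj IKajl Kegh Mln JKHabgn JNafk KLhn GKNei ILgjh Mgi Jh ILgj ILgh Ikn HMab EJfhk" ∷
  "IEghn GJNeif HNgmi Ef KLNgj KLNgj Aegh Ef IKgln IKgln KLNi IKNahm Nabk Lgh ELfg" ∷
  "MIghj EHaf JNgi HNgi HNgj Jhk ELag Hgj Ef JMin Kl Ien FGab EFag EHaj Ien FGab EFag" ∷
  "EHaj Hei FHagj EFag Ke JKhm JLah EJabf Aefg Iefg KMa EFag EAfln EHfln Jek FGab EFag" ∷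
  "EHai KLej KNal Nfg Fgn Lfg Ian FGe EFag FGe KNal LNj Jaen Jef HKil Ef Jil Kg MNab" ∷
  "MNab MNab m . GIan GIan Egk MNab MNab MNab Jil Kg MNab MNab MNab m . GIan GIan Fgk" ∷
  "MNab MNab MNab KLMajn IMgl Mej Hamn KNeh HMgk EHamn MKej Jgl MNkl Kei LNg Ng Ef KLi" ∷
  "Ji MNab MNab MNab m . GJan GJan Hj MNab MNab MNab KLi Ji MNab MNab MNab m . GJan" ∷
  "GJan Hj MNab MNab MNab KLMajn HMgk Mej Iamn LNei IMgl EIamn MLej Jgk MNkl Leh KNg Ng" ∷
  "Ji Kh Ef MNab MNab MNab Ef MNab MNab MNab Ef MNab MNab MNab Kh Ef MNab MNab MNab Ef" ∷
  "MNab MNab MNab Ef MNab MNab MNab KLMain EIan IMhl FNag Lem EIan FNag IMh KMhn Ml" ∷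
  "NMei Nei Ia" ∷
  []))

-- The upper bound

-- The hypothesis says that `k` is less than `a / d` plus one. Since `ceiling` unfolds to the
-- negated floor of the negated fraction, the bound on the floor, `ℤ.[n/d]*d≤n`, is applied to the
-- numerator `ℤ.- + a`.
≤-ceiling : ∀ a d .{{_ : ℕ.NonZero d}} → k * d < a + d → + k ℤ.≤ ceiling ((+ a) / d)
-- The non-strict bound by `ℤ.- q` is obtained as a strict bound by its successor, so that the
-- factor `d` can be cancelled from a strict inequality.
≤-ceiling {k} a d@(suc _) kd<a+d = subst (+ k ℤ.≤_) (ℤ.pred-suc (ℤ.- q))
  (ℤ.i<j⇒i≤pred[j] {+ k} {ℤ.suc (ℤ.- q)}
    (ℤ.*-cancelʳ-<-nonNeg {+ k} {ℤ.suc (ℤ.- q)} (+ d) (begin-strict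
      + k ℤ.* + d                 ≡⟨ ℤ.pos-* k d ⟨
      + (k * d)                   <⟨ ℤ.+<+ kd<a+d ⟩
      + a ℤ.+ + d                 ≡⟨ ℤ.+-comm (+ a) (+ d) ⟩
      + d ℤ.+ + a                 ≡⟨ cong (λ x → + d ℤ.+ x) (ℤ.neg-involutive (+ a)) ⟨
      + d ℤ.+ ℤ.- (ℤ.- + a)       ≤⟨ ℤ.+-monoʳ-≤ (+ d)
                                       (ℤ.neg-mono-≤ (ℤ.[n/d]*d≤n (ℤ.- + a) (+ d))) ⟩
      + d ℤ.+ ℤ.- (q ℤ.* + d)     ≡⟨ cong (λ x → + d ℤ.+ x) (ℤ.neg-distribˡ-* q (+ d)) ⟩
      + d ℤ.+ (ℤ.- q) ℤ.* + d     ≡⟨ ℤ.suc-* (ℤ.- q) (+ d) ⟨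
      ℤ.suc (ℤ.- q) ℤ.* + d       ∎)))
  where
  open ℤ.≤-Reasoning
  q : ℤ
  q = (ℤ.- + a) ℤ./ + d

-- Small cases and induction in steps of 11 coins

solvable-1-1 : Solvable 1 1
solvable-1-1 = from-just (guided 1 1 [])

solvable-2-2 : Solvable 2 2
solvable-2-2 = solvable-+ solvable-1-1 solvable-1-1

solvable-3-3 : Solvable 3 3
solvable-3-3 = solvable-+ solvable-1-1 solvable-2-2

-- The inequality expresses that `k` is at most the ceiling of 7n/11 without division, in a form to
-- which 11 coins and 7 weighings can be added. For numerals the implicit argument is found by
-- evaluation.
within : Solvable n k → {_ : True (k * 11 <? 7 * n + 11)} → ∃[ k ] Solvable n k × k * 11 < 7 * n + 11
within s {lt} = _ , s , toWitness lt

solvable-7n/11 : ∀ n → n ≢ 3 → ∃[ k ] Solvable n k × k * 11 < 7 * n + 11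
-- No coins at all is the remainder when `n` is a multiple of 11.
solvable-7n/11 0  _   = 0 , (answer [] , λ { [] → refl }) , from-yes (0 <? 11)
solvable-7n/11 1  _   = within solvable-1-1
solvable-7n/11 2  _   = within solvable-2-2
solvable-7n/11 3  3≢3 = contradiction refl 3≢3
solvable-7n/11 4  _   = within solvable-4-3
solvable-7n/11 5  _   = within (solvable-+ solvable-1-1 solvable-4-3)
solvable-7n/11 6  _   = within solvable-6-4
solvable-7n/11 7  _   = within (solvable-+ solvable-1-1 solvable-6-4)
solvable-7n/11 8  _   = within (solvable-+ solvable-2-2 solvable-6-4)
solvable-7n/11 9  _   = within solvable-9-6
solvable-7n/11 10 _   = within (solvable-+ solvable-1-1 solvable-9-6)
solvable-7n/11 (suc (suc (suc (suc (suc (suc (suc (suc (suc (suc (suc m))))))))))) _ with m ≟ 3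
-- The induction hypothesis fails for a remainder of 3 coins, so 14 coins are a base case of their
-- own.
... | yes refl = within solvable-14-9
... | no m≢3   =
  let k , s , 11k<7m+11 = solvable-7n/11 m m≢3
  in 7 + k , solvable-+ solvable-11-7 s ,
     subst ((7 + k) * 11 <_) (shift m) (ℕ.+-monoʳ-< 77 11k<7m+11)
  where
  shift : ∀ m → 77 + (7 * m + 11) ≡ 7 * (11 + m) + 11
  shift = solve-∀

-- Any upper bound will do here; it makes the search for the least number of weighings terminate.
solvable : ∀ n → ∃[ k ] Solvable n k
solvable n with n ≟ 3
... | yes refl = 3 , solvable-3-3
... | no n≢3   = map₂ proj₁ (solvable-7n/11 n n≢3)

proposition1 : ∀ {c ℓ₁ ℓ₂} (W : OrderedAbelianGroup c ℓ₁ ℓ₂) (kind : FakeKind) (n : ℕ) → 1 ≤ n →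
    ∃[ g ] (IsLeast (Sortable W kind n) g
    × (n ≢ 3 → ⌈ n ·log₃2⌉ ≤ g × (+ g) ℤ.≤ ceiling ((+ (7 * n)) / 11))
    × (n ≡ 3 → g ≡ 3))
proposition1 W kind n _ =
  g , (solvable⇒sortable W kind solvable-g , λ k → g-least k ∘ sortable⇒solvable W kind) ,
  (λ n≢3 → lower , upper n≢3) , exception
  where
  -- The minimum is taken over plans, for which solvability is decidable; it is therefore the same
  -- number for every `W` and `kind`.
  leastSolvable : ∃[ g ] IsLeast (Solvable n) g
  leastSolvable = least (solvable? n) (proj₁ (solvable n)) (proj₂ (solvable n))

  g : ℕ
  g = proj₁ leastSolvable

  solvable-g : Solvable n g
  solvable-g = proj₁ (proj₂ leastSolvable)

  g-least : ∀ k → Solvable n k → g ≤ k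
  g-least = proj₂ (proj₂ leastSolvable)

  lower : ⌈ n ·log₃2⌉ ≤ g
  -- By definition `⌈ n ·log₃2⌉` is the least `m` with `2 ^ n ≤ 3 ^ m`, and the counting bound shows
  -- that `g` is one such `m`.
  lower = proj₂ (proj₂ (least (λ m → 2 ^ n ≤? 3 ^ m) n _)) g (solvable⇒2^n≤3^k solvable-g)

  upper : n ≢ 3 → + g ℤ.≤ ceiling ((+ (7 * n)) / 11)
  upper n≢3 with solvable-7n/11 n n≢3
  ... | k , s , lt = ≤-ceiling (7 * n) 11 (ℕ.≤-<-trans (ℕ.*-monoˡ-≤ 11 (g-least k s)) lt)

  exception : n ≡ 3 → g ≡ 3
  exception refl = ℕ.≤-antisym (g-least 3 solvable-3-3)
    (ℕ.≮⇒≥ λ g<3 → ¬solvable-3-2 (solvable-mono (ℕ.s≤s⁻¹ g<3) solvable-g))
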